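{- For every integer $n\ge 1$ the following identities hold: (i) $\tau(n) = -\frac{11}{24} n\sigma_9(n) + \frac{35}{24} n\sigma_5(n) + 350\sum_{m=1}^{n-1}(n-m)\sigma_3(m)\sigma_5(n-m)$; (ii) $\tau(n) = \frac{11}{36} n\sigma_9(n) + \frac{25}{36} n\sigma_3(n)- 350\sum_{m=1}^{n-1}m\sigma_3(m)\sigma_5(n-m)$; (iii) $\tau(n) = \frac{1}{6} n\sigma_9(n) + \frac{5}{6} n\sigma_3(n) - \frac{420}{n}\sum_{m=1}^{n-1}m^2\sigma_3(m)\sigma_5(n-m)$; (iv) $\tau(n) = n\sigma_9(n) - \frac{2100}{n}\sum_{m=1}^{n-1}m(n-m)\sigma_3(m)\sigma_5(n-m)$; (v) $\tau(n) = -\frac{1}{4} n\sigma_9(n) + \frac{5}{4} n\sigma_5(n) + \frac{300}{n}\sum_{m=1}^{n-1}(n-m)^2\sigma_3(m)\sigma_5(n-m)$.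
   Context: $\tau(n)$ is Ramanujan's tau function, defined by $q\prod_{n\ge 1}(1-q^n)^{24} = \sum_{n\ge 1}\tau(n)q^n$. For $k\ge 1$, $\sigma_k(n)=\sum_{d\mid n} d^k$ (sum over positive divisors of $n$). For $n=1$ the sum $\sum_{m=1}^{n-1}$ is empty and equals $0$. -}

module Defs where

open import Algebra.Definitions.RawMonoid using (sum)
open import Data.Bool.Base using (if_then_else_)
open import Data.Fin.Base as Fin using (Fin; toℕ)
open import Data.Fin.Properties using (toℕ<n)
open import Data.Integer.Base as ℤ using (ℤ; +_; 0ℤ; 1ℤ)
open import Data.Integer.Properties as ℤ using ()
open import Data.List.Base using (applyUpTo; filter; map)
open import Data.Nat.Base using (ℕ; zero; suc; _∸_; _^_; _≤_; _<_; _≡ᵇ_; z≤n; s≤s; s≤s⁻¹)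
open import Data.Nat.Divisibility using (_∣?_)
open import Data.Nat.ListAction using () renaming (sum to sumℕ)
open import Data.Nat.Properties using (≤-trans; m≤n⇒m<n∨m≡n)
open import Data.Product.Base using (∃-syntax; _,_)
open import Data.Rational.Base using (ℚ; _/_)
open import Data.Sum.Base using (inj₁; inj₂)
open import Relation.Binary.PropositionalEquality

-- The range 1, …, n leaves out 0, so only positive divisors occur.
σ : ℕ → ℕ → ℕ
σ k n = sumℕ (map (_^ k) (filter (_∣? n) (applyUpTo suc n)))

∑₁< : ℕ → (ℕ → ℕ) → ℕ
∑₁< n f = sumℕ (map f (applyUpTo suc (n ∸ 1)))

infix 5 ∑₁<
syntax ∑₁< n (λ m → e) = ∑[1≤ m < n ] e

ι : ℕ → ℚ
ι n = + n / 1

-- Formal power series over ℤ in the variable q, given by their coefficients.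
Series : Set
Series = ℕ → ℤ

infixl 6 _⊖_
infixl 7 _⊛_
infixr 8 _^ₛ_
infix  9 q^_

q^_ : ℕ → Series
(q^ n) k = if k ≡ᵇ n then 1ℤ else 0ℤ

1ₛ : Series
1ₛ = q^ 0

_⊖_ : Series → Series → Series
(f ⊖ g) n = f n ℤ.- g n

_⊛_ : Series → Series → Series
(f ⊛ g) n = sum ℤ.+-0-rawMonoid {suc n} (λ i → f (toℕ i) ℤ.* g (n ∸ toℕ i))

_^ₛ_ : Series → ℕ → Series
f ^ₛ zero  = 1ₛ
f ^ₛ suc m = f ⊛ f ^ₛ m

∏ : (ℕ → Series) → ℕ → Series
∏ F zero    = 1ₛ
∏ F (suc N) = F (suc N) ⊛ ∏ F N

-- The coefficient of q^k in the infinite product, for factors F n whose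
-- difference from 1 is divisible by q^n: those with n > k do not affect it, so
-- it is already that of the k-th partial product.
∏∞ : (ℕ → Series) → Series
∏∞ F k = ∏ F k k

factor : ℕ → ℕ → Series
factor m n = (1ₛ ⊖ q^ n) ^ₛ m

τ : ℕ → ℤ
τ = q^ 1 ⊛ ∏∞ (factor 24)

-- Coefficientwise convergence, the usual topology on formal power series;
-- ∏factor-converges below justifies the use of ∏∞ in τ.
_⟶_ : (ℕ → Series) → Series → Set
P ⟶ S = ∀ k → ∃[ N ] (∀ M → N ≤ M → P M k ≡ S k)

private
  _≡1-to_ : Series → ℕ → Set
  g ≡1-to k = ∀ j → j ≤ k → g j ≡ 1ₛ j

  sum-0 : ∀ {n} (t : Fin n → ℤ) → (∀ i → t i ≡ 0ℤ) → sum ℤ.+-0-rawMonoid t ≡ 0ℤ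
  sum-0 {zero}  t t≡0 = refl
  sum-0 {suc n} t t≡0 = cong₂ ℤ._+_ (t≡0 Fin.zero) (sum-0 (λ i → t (Fin.suc i)) (λ i → t≡0 (Fin.suc i)))

  ⊛-≡1 : ∀ {g k} f → g ≡1-to k → ∀ j → j ≤ k → (g ⊛ f) j ≡ f j
  ⊛-≡1 {g} f g≡1 j j≤k = trans
    (cong₂ ℤ._+_
      (trans (cong (ℤ._* f j) (g≡1 0 z≤n)) (ℤ.*-identityˡ (f j)))
      (sum-0 {j} _ (λ i → cong (ℤ._* f (j ∸ suc (toℕ i))) (g≡1 (suc (toℕ i)) (≤-trans (toℕ<n i) j≤k)))))
    (ℤ.+-identityʳ (f j))

  ^ₛ-≡1 : ∀ {g k} m → g ≡1-to k → (g ^ₛ m) ≡1-to k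
  ^ₛ-≡1         zero    g≡1 j j≤k = refl
  ^ₛ-≡1 {g} {k} (suc m) g≡1 j j≤k = trans (⊛-≡1 (g ^ₛ m) g≡1 j j≤k) (^ₛ-≡1 m g≡1 j j≤k)

  q^-< : ∀ {j n} → j < n → (q^ n) j ≡ 0ℤ
  q^-< {zero}  {suc n} _   = refl
  q^-< {suc j} {suc n} j<n = q^-< {j} {n} (s≤s⁻¹ j<n)

  1-q^-≡1 : ∀ N → (1ₛ ⊖ q^ suc N) ≡1-to N
  1-q^-≡1 N j j≤N = trans (cong (λ x → 1ₛ j ℤ.- x) (q^-< {j} {suc N} (s≤s j≤N))) (ℤ.+-identityʳ (1ₛ j))

  ∏-stable : ∀ F → (∀ N → F (suc N) ≡1-to N) → ∀ k M → k ≤ M → ∏ F M k ≡ ∏ F k k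
  ∏-stable F F≡1 k zero    z≤n   = refl
  ∏-stable F F≡1 k (suc M) k≤1+M with m≤n⇒m<n∨m≡n k≤1+M
  ... | inj₁ k<1+M = trans (⊛-≡1 {F (suc M)} (∏ F M) (F≡1 M) k (s≤s⁻¹ k<1+M)) (∏-stable F F≡1 k M (s≤s⁻¹ k<1+M))
  ... | inj₂ refl  = refl

∏factor-converges : ∀ m → ∏ (factor m) ⟶ ∏∞ (factor m)
∏factor-converges m k = k , ∏-stable (factor m) (λ N → ^ₛ-≡1 {1ₛ ⊖ q^ suc N} m (1-q^-≡1 N)) k

{-# OPTIONS --safe #-}

-- Write L a = q^a / (1 - q^a), so that ∑ σ_k(n) q^n = ∑_c c^k L c. Everything
-- rests on the identity L a L b = L (a + b) (1 + L a + L b). Let G be symmetric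
-- with G(x, y) = G(x, x - y). Multiply the identity by G(a + b, b), sum over
-- a, b > 0 and put c = a + b on the right: this gives (Skoruppa)
--   ∑_{a,b} (G(a + b, b) - G(a, b)) L a L b = ∑_c L c ∑_{b<c} G(c, b) - ∑_c G(c, c) (L c)².
-- Four polynomials G yield Ramanujan's differential equations
--   12 DP = P² - Q,   3 DQ = PQ - R,   2 DR = PR - Q²   (D = q d/dq)
-- and Q R = 1 - 264 ∑ σ₉(n) q^n. By these equations Q³ - R² solves D X = P X, and
-- so does Δ = ∑ τ(n) q^n, by logarithmic differentiation of the product; a
-- solution with zero constant term is determined by its coefficient of q, hence
-- 1728 Δ = Q³ - R². Differentiating Q R once and twice then expresses Δ and D Δ
-- through the derivatives of Q, R and Q R, which is (i) and (iv); the other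
-- three identities are combinations of these by the Leibniz rule.
module Submission where

open import Defs
open import Algebra.Bundles using (CommutativeRing)
import Algebra.Properties.AbelianGroup
import Algebra.Properties.Semiring.Exp
import Algebra.Solver.Ring
open import Algebra.Solver.Ring.AlmostCommutativeRing
  using (fromCommutativeRing; _-Raw-AlmostCommutative⟶_; Induced-equivalence)
open import Algebra.Structures using (IsCommutativeRing)
open import Data.Bool.Base using (if_then_else_; true; false; T)
open import Data.Fin.Base using (zero; suc)
open import Data.Integer.Base as ℤ using (ℤ; +_; 0ℤ; 1ℤ; -[1+_]; NonZero)
import Data.Integer.Properties as ℤ
open import Data.Integer.Solver using (module +-*-Solver)
open import Data.List.Base using (applyUpTo; filter; map)
open import Data.Maybe.Base using (just; nothing)
open import Data.Nat.Base as ℕ using (ℕ; zero; suc; _∸_; _^_; _≤_; _<_; s≤s; _≡ᵇ_)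
open import Data.Nat.Divisibility using (_∣_; _∣?_; >⇒∤; ∣-refl; ∣m∣n⇒∣m+n; ∣m+n∣m⇒∣n)
open import Data.Nat.ListAction using () renaming (sum to sumℕ)
import Data.Nat.Properties as ℕ
open import Data.Product.Base using (_×_; _,_; proj₂)
open import Data.Rational.Base using (ℚ; fromℚᵘ)
import Data.Rational.Properties as ℚ
open import Data.Rational.Solver using () renaming (module +-*-Solver to ℚ-Solver)
open import Data.Rational.Unnormalised.Base as ℚᵘ using (mkℚᵘ; *≡*)
import Data.Rational.Unnormalised.Properties as ℚᵘ
open import Data.Sum.Base using (inj₂)
open import Data.Unit.Base using (tt)
open import Data.Vec.Base using ([]; _∷_)
open import Function.Base using (_∘_)
open import Function.Bundles using (mk⇔)
open import Level using (0ℓ)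
open import Relation.Binary.Consequences using (dec⇒weaklyDec)
open import Relation.Binary.Definitions using (WeaklyDecidable)
open import Relation.Binary.PropositionalEquality
open import Relation.Nullary.Decidable using (yes; no; does; dec-true; dec-false; does-⇔)
open import Relation.Unary using (Pred; Decidable)

-- The two symmetries of G combine to G(a + b, b) = G(a, -b). The weight G(a, -b) - G(a, b) on the
-- left therefore keeps only odd powers of b, and for homogeneous G of even degree only odd powers
-- of a: this is why only the series of σ₁, σ₃, σ₅, ... enter. On the right ∑ G(c, b) over b is a
-- polynomial in c by Faulhaber's formula. Products of divisor sums are thus reduced to polynomial
-- identities over ℤ, in place of the usual appeal to the dimension of spaces of modular forms.
-- Nothing is inverted in ℤ[[q]]: expansions of rational functions are compared as fixed points of X
-- ↦ Z + q^a X, and rational constants are cleared by multiplying both sides, so that denominators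
-- appear only in the final passage from ℤ to ℚ.

-- The ring ℤ[[q]] and its derivation `D`.

module PowerSeries where
  open import Data.Integer.Base using (_+_; _*_; -_; _-_)
  open import Data.Integer.Properties
  open ≡-Reasoning
  open +-*-Solver using (_:+_; _:*_; _:=_; con) renaming (solve to solveℤ)

  infixl 6 _⊕_
  infixl 7 _⊗_
  infix  4 _≈_
  infixr 7 _·_

  _≈_ : Series → Series → Set
  _≈_ = _≗_

  κ : ℤ → Series
  κ z zero    = z
  κ z (suc n) = 0ℤ

  κ0 : ∀ k → κ 0ℤ k ≡ 0ℤ
  κ0 zero    = refl
  κ0 (suc k) = refl

  _⊕_ : Series → Series → Series
  (f ⊕ g) n = f n + g n

  ⊝_ : Series → Series
  (⊝ f) n = - f n

  _·_ : ℤ → Series → Series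
  (z · f) n = z * f n

  -- The sum in `_⊛_` unfolds to `(f ⊗ g) (suc n) = f 0 * g (suc n) + (shift f ⊗ g) n`; the
  -- inductions on the degree below run along this equation.
  shift : Series → Series
  shift f = f ∘ suc

  D : Series → Series
  D f n = + n * f n

  -- The opaque copy of ⊛ keeps conversion checks from unfolding products into
  -- sums of coefficients.
  opaque
    _⊗_ : Series → Series → Series
    _⊗_ = _⊛_

    ⊗≈⊛ : ∀ f g → f ⊗ g ≈ f ⊛ g
    ⊗≈⊛ f g n = refl

    -- The bound on the degrees is what later allows infinite sums and products to be exchanged for
    -- partial ones in a fixed degree.
    ⊗-cong≤ : ∀ {f f′ g g′} n → (∀ m → m ℕ.≤ n → f m ≡ f′ m) → (∀ m → m ℕ.≤ n → g m ≡ g′ m) →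
              (f ⊗ g) n ≡ (f′ ⊗ g′) n
    ⊗-cong≤ zero    f≡ g≡ = cong (_+ 0ℤ) (cong₂ _*_ (f≡ 0 ℕ.z≤n) (g≡ 0 ℕ.z≤n))
    ⊗-cong≤ (suc n) f≡ g≡ = cong₂ _+_ (cong₂ _*_ (f≡ 0 ℕ.z≤n) (g≡ (suc n) (ℕ.s≤s ℕ.≤-refl)))
      (⊗-cong≤ n (λ m m≤n → f≡ (suc m) (ℕ.s≤s m≤n)) (λ m m≤n → g≡ m (ℕ.m≤n⇒m≤1+n m≤n)))

    ⊗-cong : ∀ {f f′ g g′} → f ≈ f′ → g ≈ g′ → f ⊗ g ≈ f′ ⊗ g′
    ⊗-cong f≈ g≈ n = ⊗-cong≤ n (λ m _ → f≈ m) (λ m _ → g≈ m)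

    ⊗-congˡ : ∀ f {g g′} → g ≈ g′ → f ⊗ g ≈ f ⊗ g′
    ⊗-congˡ f g≈ = ⊗-cong {f} (λ _ → refl) g≈

    ⊗-congʳ : ∀ g {f f′} → f ≈ f′ → f ⊗ g ≈ f′ ⊗ g
    ⊗-congʳ g f≈ = ⊗-cong {g = g} f≈ (λ _ → refl)

    ⊗-shiftʳ : ∀ f g n → (f ⊗ g) (suc n) ≡ (f ⊗ shift g) n + f (suc n) * g 0
    ⊗-shiftʳ f g zero    = solveℤ 4 (λ a b c d → a :* b :+ (c :* d :+ con 0ℤ) :=
             a :* b :+ con 0ℤ :+ c :* d) refl (f 0) (g 1) (f 1) (g 0)
    ⊗-shiftʳ f g (suc n) = trans (cong (_+_ (f 0 * g (suc (suc n)))) (⊗-shiftʳ (shift f) g n)) (sym (+-assoc (f 0 * g (suc (suc n))) _ _))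

    ⊗-comm : ∀ f g → f ⊗ g ≈ g ⊗ f
    ⊗-comm f g zero    = cong (_+ 0ℤ) (*-comm (f 0) (g 0))
    ⊗-comm f g (suc n) = begin
      f 0 * g (suc n) + (shift f ⊗ g) n ≡⟨ cong₂ _+_ (*-comm (f 0) (g (suc n))) (⊗-comm (shift f) g n) ⟩
      g (suc n) * f 0 + (g ⊗ shift f) n ≡⟨ +-comm (g (suc n) * f 0) _ ⟩
      (g ⊗ shift f) n + g (suc n) * f 0 ≡⟨ ⊗-shiftʳ g f n ⟨
      (g ⊗ f) (suc n)                   ∎

    ⊗-distribʳ : ∀ h f g → (f ⊕ g) ⊗ h ≈ f ⊗ h ⊕ g ⊗ h
    ⊗-distribʳ h f g zero    = solveℤ 3 (λ a b c → (a :+ b) :* c :+ con 0ℤ :=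
             (a :* c :+ con 0ℤ) :+ (b :* c :+ con 0ℤ)) refl (f 0) (g 0) (h 0)
    ⊗-distribʳ h f g (suc n) = trans
      (cong (_+_ ((f 0 + g 0) * h (suc n))) (⊗-distribʳ h (shift f) (shift g) n))
      (solveℤ 5 (λ a b c x y → (a :+ b) :* c :+ (x :+ y) := (a :* c :+ x) :+ (b :* c :+ y)) refl (f 0) (g 0) (h (suc n)) _ _)

    ⊗-distribˡ : ∀ h f g → h ⊗ (f ⊕ g) ≈ h ⊗ f ⊕ h ⊗ g
    ⊗-distribˡ h f g n = begin
      (h ⊗ (f ⊕ g)) n     ≡⟨ ⊗-comm h (f ⊕ g) n ⟩
      ((f ⊕ g) ⊗ h) n     ≡⟨ ⊗-distribʳ h f g n ⟩
      (f ⊗ h ⊕ g ⊗ h) n   ≡⟨ cong₂ _+_ (⊗-comm f h n) (⊗-comm g h n) ⟩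
      (h ⊗ f ⊕ h ⊗ g) n   ∎

    ·-⊗ : ∀ z f g → (z · f) ⊗ g ≈ z · (f ⊗ g)
    ·-⊗ z f g zero    = solveℤ 3 (λ a b c → a :* b :* c :+ con 0ℤ := a :* (b :* c :+ con 0ℤ)) refl z (f 0) (g 0)
    ·-⊗ z f g (suc n) = trans (cong (_+_ ((z * f 0) * g (suc n))) (·-⊗ z (shift f) g n))
      (solveℤ 4 (λ a b c x → a :* b :* c :+ a :* x := a :* (b :* c :+ x)) refl z (f 0) (g (suc n)) _)

    ⊗-assoc : ∀ f g h → (f ⊗ g) ⊗ h ≈ f ⊗ (g ⊗ h)
    ⊗-assoc f g h zero    = solveℤ 3 (λ a b c → (a :* b :+ con 0ℤ) :* c :+ con 0ℤ :=
             a :* (b :* c :+ con 0ℤ) :+ con 0ℤ) refl (f 0) (g 0) (h 0)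
    ⊗-assoc f g h (suc n) = begin
      -- `shift (f ⊗ g)` is by definition `f 0 · shift g ⊕ shift f ⊗ g`.
      (f 0 * g 0 + 0ℤ) * h (suc n) + ((f 0 · shift g ⊕ shift f ⊗ g) ⊗ h) n
        ≡⟨ cong (_+_ ((f 0 * g 0 + 0ℤ) * h (suc n))) (⊗-distribʳ h (f 0 · shift g) (shift f ⊗ g) n) ⟩
      (f 0 * g 0 + 0ℤ) * h (suc n) + (((f 0 · shift g) ⊗ h) n + ((shift f ⊗ g) ⊗ h) n)
        ≡⟨ cong (_+_ ((f 0 * g 0 + 0ℤ) * h (suc n))) (cong₂ _+_ (·-⊗ (f 0) (shift g) h n) (⊗-assoc (shift f) g h n)) ⟩
      (f 0 * g 0 + 0ℤ) * h (suc n) + (f 0 * (shift g ⊗ h) n + (shift f ⊗ (g ⊗ h)) n)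
        ≡⟨ solveℤ 5 (λ a b c x y → (a :* b :+ con 0ℤ) :* c :+ (a :* x :+ y) :=
                 a :* (b :* c :+ x) :+ y) refl (f 0) (g 0) (h (suc n)) _ _ ⟩
      f 0 * (g 0 * h (suc n) + (shift g ⊗ h) n) + (shift f ⊗ (g ⊗ h)) n ∎

    ⊗-zeroˡ : ∀ {f} g → f ≈ κ 0ℤ → f ⊗ g ≈ κ 0ℤ
    ⊗-zeroˡ {f} g f≈0 zero    = cong (λ x → x * g 0 + 0ℤ) (f≈0 0)
    ⊗-zeroˡ {f} g f≈0 (suc n) = cong₂ _+_ (cong (_* g (suc n)) (f≈0 0)) (trans (⊗-zeroˡ {shift f} g (λ k → trans (f≈0 (suc k)) (sym (κ0 k))) n) (κ0 n))

    κ-⊗ : ∀ z f → κ z ⊗ f ≈ z · f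
    κ-⊗ z f zero    = +-identityʳ _
    κ-⊗ z f (suc n) = trans (cong (_+_ (z * f (suc n))) (trans (⊗-zeroˡ {shift (κ z)} f (sym ∘ κ0) n) (κ0 n))) (+-identityʳ _)

    1ₛ≈κ1 : 1ₛ ≈ κ 1ℤ
    1ₛ≈κ1 zero    = refl
    1ₛ≈κ1 (suc n) = refl

    ⊗-identityˡ : ∀ f → 1ₛ ⊗ f ≈ f
    ⊗-identityˡ f n = trans (⊗-cong {g = f} 1ₛ≈κ1 (λ _ → refl) n) (trans (κ-⊗ 1ℤ f n) (*-identityˡ (f n)))

    -- `D` and `shift` fail to commute by exactly one term, `shift (D f) = shift f ⊕ D (shift f)`,
    -- and this term absorbs the 1 in the factor 1 + n.
    D-⊗ : ∀ f g → D (f ⊗ g) ≈ D f ⊗ g ⊕ f ⊗ D g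
    D-⊗ f g zero    = solveℤ 2 (λ a b → con 0ℤ :* (a :* b :+ con 0ℤ) :=
             (con 0ℤ :* a :* b :+ con 0ℤ) :+ (a :* (con 0ℤ :* b) :+ con 0ℤ)) refl (f 0) (g 0)
    D-⊗ f g (suc n) = begin
      (1ℤ + + n) * (f 0 * g (suc n) + (shift f ⊗ g) n)
        ≡⟨ solveℤ 4 (λ k a b x → (con 1ℤ :+ k) :* (a :* b :+ x) :=
                 x :+ (a :* ((con 1ℤ :+ k) :* b) :+ k :* x)) refl (+ n) (f 0) (g (suc n)) _ ⟩
      (shift f ⊗ g) n + (f 0 * D g (suc n) + D (shift f ⊗ g) n)
        ≡⟨ cong (λ x → (shift f ⊗ g) n + (f 0 * D g (suc n) + x)) (D-⊗ (shift f) g n) ⟩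
      (shift f ⊗ g) n + (f 0 * D g (suc n) + ((D (shift f) ⊗ g) n + (shift f ⊗ D g) n))
        ≡⟨ solveℤ 4 (λ x y z w → x :+ (y :+ (z :+ w)) := (x :+ z) :+ (y :+ w)) refl ((shift f ⊗ g) n) (f 0 * D g (suc n)) _ _ ⟩
      ((shift f ⊗ g) n + (D (shift f) ⊗ g) n) + (f ⊗ D g) (suc n)
        ≡⟨ cong (_+ (f ⊗ D g) (suc n)) (⊗-distribʳ g (shift f) (D (shift f)) n) ⟨
      ((shift f ⊕ D (shift f)) ⊗ g) n + (f ⊗ D g) (suc n)
        ≡⟨ cong (_+ (f ⊗ D g) (suc n)) (⊗-cong {g = g} (λ m → suc-* (+ m) (f (suc m))) (λ _ → refl) n) ⟨
      (shift (D f) ⊗ g) n + (f ⊗ D g) (suc n)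
        ≡⟨ cong (_+ (f ⊗ D g) (suc n)) (trans (cong (_+ (shift (D f) ⊗ g) n) (cong (_* g (suc n)) (*-zeroˡ (f 0)))) (+-identityˡ ((shift (D f) ⊗ g) n))) ⟨
      (D f ⊗ g) (suc n) + (f ⊗ D g) (suc n) ∎

    seriesIsCommutativeRing : IsCommutativeRing _≈_ _⊕_ _⊗_ ⊝_ (κ 0ℤ) 1ₛ
    seriesIsCommutativeRing = record
      { isRing = record
        { +-isAbelianGroup = record
          { isGroup = record
            { isMonoid = record
              { isSemigroup = record
                { isMagma = record
                  { isEquivalence = record
                    { refl = λ _ → refl ; sym = λ p n → sym (p n) ; trans = λ p q n → trans (p n) (q n) }
                  ; ∙-cong = λ p q n → cong₂ _+_ (p n) (q n) }
                ; assoc = λ f g h n → +-assoc (f n) (g n) (h n) }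
              ; identity = (λ f n → trans (cong (_+ f n) (κ0 n)) (+-identityˡ (f n)))
                         , (λ f n → trans (cong (_+_ (f n)) (κ0 n)) (+-identityʳ (f n))) }
            ; inverse = (λ f n → trans (+-inverseˡ (f n)) (sym (κ0 n)))
                      , (λ f n → trans (+-inverseʳ (f n)) (sym (κ0 n)))
            ; ⁻¹-cong = λ p n → cong -_ (p n) }
          ; comm = λ f g n → +-comm (f n) (g n) }
        ; *-cong = ⊗-cong
        ; *-assoc = ⊗-assoc
        ; *-identity = ⊗-identityˡ , (λ f n → trans (⊗-comm f 1ₛ n) (⊗-identityˡ f n))
        ; distrib = ⊗-distribˡ , ⊗-distribʳ }
      ; *-comm = ⊗-comm }

  seriesRing : CommutativeRing 0ℓ 0ℓ
  seriesRing = record { isCommutativeRing = seriesIsCommutativeRing }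

  κ-hom : CommutativeRing.rawRing +-*-commutativeRing -Raw-AlmostCommutative⟶ fromCommutativeRing seriesRing
  κ-hom = record
    { ⟦_⟧    = κ
    ; +-homo = λ { a b zero → refl ; a b (suc n) → refl }
    ; *-homo = λ { a b n → trans (κ-* a b n) (sym (κ-⊗ a (κ b) n)) }
    ; -‿homo = λ { a zero → refl ; a (suc n) → refl }
    ; 0-homo = λ _ → refl
    ; 1-homo = λ n → sym (1ₛ≈κ1 n)
    }
    where
    κ-* : ∀ a b n → κ (a * b) n ≡ a * κ b n
    κ-* a b zero    = refl
    κ-* a b (suc n) = sym (*-zeroʳ a)

  κ-weakly-decidable : WeaklyDecidable (Induced-equivalence κ-hom)
  κ-weakly-decidable a b with a ≟ b
  ... | yes refl = just (λ _ → refl)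
  ... | no _     = nothing

  -- Coefficients are integers, embedded by `κ`, so that the solver computes with numerals inside
  -- identities between series.
  module SeriesSolver = Algebra.Solver.Ring
    (CommutativeRing.rawRing +-*-commutativeRing) (fromCommutativeRing seriesRing) κ-hom
    κ-weakly-decidable

  D-cong : ∀ {f g} → f ≈ g → D f ≈ D g
  D-cong f≈g n = cong (_*_ (+ n)) (f≈g n)

  D-⊕ : ∀ f g → D (f ⊕ g) ≈ D f ⊕ D g
  D-⊕ f g n = *-distribˡ-+ (+ n) (f n) (g n)

  D-⊝ : ∀ f → D (⊝ f) ≈ ⊝ D f
  D-⊝ f n = sym (neg-distribʳ-* (+ n) (f n))

  D-κ : ∀ z → D (κ z) ≈ κ 0ℤ
  D-κ z zero    = refl
  D-κ z (suc n) = *-zeroʳ (+ suc n)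

  D-κ⊗ : ∀ z f → D (κ z ⊗ f) ≈ κ z ⊗ D f
  D-κ⊗ z f n = trans (cong (_*_ (+ n)) (κ-⊗ z f n))
    (trans (solveℤ 3 (λ n z x → n :* (z :* x) := z :* (n :* x)) refl (+ n) z (f n)) (sym (κ-⊗ z (D f) n)))

open PowerSeries
module ℛ = CommutativeRing seriesRing

-- Finite sums over squares, triangles and antidiagonals.

module Sums where
  open import Data.Integer.Base using (_+_; _*_; -_; _-_)
  open import Data.Integer.Properties
  open ≡-Reasoning
  open +-*-Solver

  ∑ : ℕ → (ℕ → ℤ) → ℤ
  ∑ zero    φ = 0ℤ
  ∑ (suc n) φ = ∑ n φ + φ (suc n)

  ∑-cong : ∀ n {φ ψ} → (∀ i → i < n → φ (suc i) ≡ ψ (suc i)) → ∑ n φ ≡ ∑ n ψ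
  ∑-cong zero    φ≡ψ = refl
  ∑-cong (suc n) φ≡ψ = cong₂ _+_ (∑-cong n (λ i i<n → φ≡ψ i (ℕ.m<n⇒m<1+n i<n))) (φ≡ψ n ℕ.≤-refl)

  ∑-+ : ∀ n φ ψ → ∑ n (λ i → φ i + ψ i) ≡ ∑ n φ + ∑ n ψ
  ∑-+ zero    φ ψ = refl
  ∑-+ (suc n) φ ψ = trans (cong (_+ (φ (suc n) + ψ (suc n))) (∑-+ n φ ψ))
    (solve 4 (λ a b c d → a :+ b :+ (c :+ d) := a :+ c :+ (b :+ d)) refl (∑ n φ) (∑ n ψ) (φ (suc n)) (ψ (suc n)))

  ∑-*ˡ : ∀ n z φ → ∑ n (λ i → z * φ i) ≡ z * ∑ n φ
  ∑-*ˡ zero    z φ = sym (*-zeroʳ z)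
  ∑-*ˡ (suc n) z φ = trans (cong (_+ z * φ (suc n)) (∑-*ˡ n z φ)) (sym (*-distribˡ-+ z (∑ n φ) (φ (suc n))))

  ∑-*ʳ : ∀ n z φ → ∑ n (λ i → φ i * z) ≡ ∑ n φ * z
  ∑-*ʳ zero    z φ = refl
  ∑-*ʳ (suc n) z φ = trans (cong (_+ φ (suc n) * z) (∑-*ʳ n z φ)) (sym (*-distribʳ-+ z (∑ n φ) (φ (suc n))))

  ∑-head : ∀ n φ → ∑ (suc n) φ ≡ φ 1 + ∑ n (φ ∘ suc)
  ∑-head zero    φ = +-comm 0ℤ (φ 1)
  ∑-head (suc n) φ = trans (cong (_+ φ (suc (suc n))) (∑-head n φ)) (+-assoc (φ 1) (∑ n (φ ∘ suc)) (φ (suc (suc n))))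

  ∑-reverse : ∀ n φ → ∑ n φ ≡ ∑ n (λ i → φ (suc n ∸ i))
  ∑-reverse zero    φ = refl
  ∑-reverse (suc n) φ = begin
    ∑ n φ + φ (suc n)                            ≡⟨ +-comm (∑ n φ) (φ (suc n)) ⟩
    φ (suc n) + ∑ n φ                            ≡⟨ cong (_+_ (φ (suc n))) (∑-reverse n φ) ⟩
    φ (suc n) + ∑ n (λ i → φ (suc n ∸ i))        ≡⟨ ∑-head n (λ i → φ (suc (suc n) ∸ i)) ⟨
    ∑ (suc n) (λ i → φ (suc (suc n) ∸ i))        ∎

  ∑-extend : ∀ m d φ → (∀ i → m ≤ i → φ (suc i) ≡ 0ℤ) → ∑ (d ℕ.+ m) φ ≡ ∑ m φ
  ∑-extend m zero    φ φ≡0 = refl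
  ∑-extend m (suc d) φ φ≡0 = trans (cong₂ _+_ (∑-extend m d φ φ≡0) (φ≡0 (d ℕ.+ m) (ℕ.m≤n+m m d))) (+-identityʳ (∑ m φ))

  ∑-truncate : ∀ {m n} φ → m ≤ n → (∀ i → m ≤ i → φ (suc i) ≡ 0ℤ) → ∑ n φ ≡ ∑ m φ
  ∑-truncate {m} {n} φ m≤n φ≡0 = trans (cong (λ k → ∑ k φ) (sym (ℕ.m∸n+n≡m m≤n))) (∑-extend m (n ∸ m) φ φ≡0)

  square : ℕ → (ℕ → ℕ → ℤ) → ℤ
  square n χ = ∑ n (λ a → ∑ n (χ a))

  triangle : ℕ → (ℕ → ℕ → ℤ) → ℤ
  triangle n χ = ∑ n (λ c → ∑ (c ∸ 1) (χ c))

  square-cong : ∀ n {χ χ′} → (∀ a b → χ (suc a) (suc b) ≡ χ′ (suc a) (suc b)) → square n χ ≡ square n χ′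
  square-cong n χ≡χ′ = ∑-cong n (λ a _ → ∑-cong n (λ b _ → χ≡χ′ a b))

  square-+ : ∀ n χ χ′ → square n (λ a b → χ a b + χ′ a b) ≡ square n χ + square n χ′
  square-+ n χ χ′ = trans (∑-cong n (λ a _ → ∑-+ n (χ (suc a)) (χ′ (suc a))))
    (∑-+ n (λ a → ∑ n (χ a)) (λ a → ∑ n (χ′ a)))

  square-*ˡ : ∀ n z χ → square n (λ a b → z * χ a b) ≡ z * square n χ
  square-*ˡ n z χ = trans (∑-cong n (λ a _ → ∑-*ˡ n z (χ (suc a)))) (∑-*ˡ n z (λ a → ∑ n (χ a)))

  triangle-cong : ∀ n {χ χ′} → (∀ c b → b < c → c < n → χ (suc c) (suc b) ≡ χ′ (suc c) (suc b)) → triangle n χ ≡ triangle n χ′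
  triangle-cong n χ≡χ′ = ∑-cong n (λ c c<n → ∑-cong c (λ b b<c → χ≡χ′ c b b<c c<n))

  triangle-+ : ∀ n χ χ′ → triangle n (λ c b → χ c b + χ′ c b) ≡ triangle n χ + triangle n χ′
  triangle-+ n χ χ′ = trans (∑-cong n (λ c _ → ∑-+ c (χ (suc c)) (χ′ (suc c))))
    (∑-+ n (λ c → ∑ (c ∸ 1) (χ c)) (λ c → ∑ (c ∸ 1) (χ′ c)))

  square-symmetric : ∀ n χ → (∀ a b → χ a b ≡ χ b a) →
                     square n χ ≡ triangle n χ + triangle n χ + ∑ n (λ c → χ c c)
  square-symmetric zero    χ χ-sym = refl
  square-symmetric (suc n) χ χ-sym = begin
    ∑ n (λ a → ∑ n (χ a) + χ a (suc n)) + (∑ n (χ (suc n)) + χ (suc n) (suc n))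
      ≡⟨ cong (_+ (∑ n (χ (suc n)) + χ (suc n) (suc n))) (∑-+ n (λ a → ∑ n (χ a)) (λ a → χ a (suc n))) ⟩
    square n χ + ∑ n (λ a → χ a (suc n)) + (∑ n (χ (suc n)) + χ (suc n) (suc n))
      ≡⟨ cong₂ (λ x y → x + y + (∑ n (χ (suc n)) + χ (suc n) (suc n))) (square-symmetric n χ χ-sym) (∑-cong n (λ a _ → χ-sym (suc a) (suc n))) ⟩
    triangle n χ + triangle n χ + ∑ n (λ c → χ c c) + ∑ n (χ (suc n)) + (∑ n (χ (suc n)) + χ (suc n) (suc n))
      ≡⟨ solve 4 (λ t d r x → t :+ t :+ d :+ r :+ (r :+ x) :=
               (t :+ r) :+ (t :+ r) :+ (d :+ x)) refl (triangle n χ) (∑ n (λ c → χ c c)) (∑ n (χ (suc n))) (χ (suc n) (suc n)) ⟩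
    triangle (suc n) χ + triangle (suc n) χ + ∑ (suc n) (λ c → χ c c) ∎

  -- Entries with a + b > n vanish, so row a may be cut at n - a; what remains is sorted by c = a +
  -- b.
  square-diagonals : ∀ n χ → (∀ a b → n < suc a ℕ.+ suc b → χ (suc a) (suc b) ≡ 0ℤ) →
                     square n χ ≡ triangle n (λ c a → χ a (c ∸ a))
  square-diagonals n χ χ≡0 = trans
    (∑-cong n (λ a a<n → ∑-truncate (χ (suc a)) (ℕ.m∸n≤m n (suc a)) (λ b n∸a≤b → χ≡0 a b (outside a b n∸a≤b))))
    (antidiagonals n)
    where
    outside : ∀ a b → n ∸ suc a ≤ b → n < suc a ℕ.+ suc b
    outside a b n∸a≤b = ℕ.<-≤-trans (s≤s (ℕ.m≤n+m∸n n (suc a)))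
      (ℕ.≤-trans (s≤s (ℕ.+-monoʳ-≤ (suc a) n∸a≤b)) (ℕ.≤-reflexive (sym (ℕ.+-suc (suc a) b))))

    -- Raising m to m + 1 lengthens row a by the entry at m + 1 - a, and these new entries form the
    -- antidiagonal c = m + 1.
    antidiagonals : ∀ m → ∑ m (λ a → ∑ (m ∸ a) (χ a)) ≡ triangle m (λ c a → χ a (c ∸ a))
    antidiagonals zero    = refl
    antidiagonals (suc m) = begin
      ∑ m (λ a → ∑ (suc m ∸ a) (χ a)) + ∑ (m ∸ m) (χ (suc m))
        ≡⟨ cong₂ _+_ (∑-cong m (λ a a<m → peel a a<m)) (cong (λ k → ∑ k (χ (suc m))) (ℕ.n∸n≡0 m)) ⟩
      ∑ m (λ a → ∑ (m ∸ a) (χ a) + χ a (suc m ∸ a)) + 0ℤ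
        ≡⟨ +-identityʳ _ ⟩
      ∑ m (λ a → ∑ (m ∸ a) (χ a) + χ a (suc m ∸ a))
        ≡⟨ ∑-+ m (λ a → ∑ (m ∸ a) (χ a)) (λ a → χ a (suc m ∸ a)) ⟩
      ∑ m (λ a → ∑ (m ∸ a) (χ a)) + ∑ m (λ a → χ a (suc m ∸ a))
        ≡⟨ cong (_+ ∑ m (λ a → χ a (suc m ∸ a))) (antidiagonals m) ⟩
      triangle (suc m) (λ c a → χ a (c ∸ a)) ∎
      where
      peel : ∀ a → a < m → ∑ (m ∸ a) (χ (suc a)) ≡ ∑ (m ∸ suc a) (χ (suc a)) + χ (suc a) (m ∸ a)
      peel a a<m = subst (λ k → ∑ k (χ (suc a)) ≡ ∑ (m ∸ suc a) (χ (suc a)) + χ (suc a) k) (sym (ℕ.+-∸-assoc 1 a<m)) refl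

open Sums

-- The series q^a / (1 - q^a).

module GeometricSeries where
  open import Data.Integer.Base using (_+_; _*_; -_; _-_)
  open import Data.Integer.Properties
  open import Relation.Binary.Reasoning.Setoid ℛ.setoid

  opaque
    unfolding _⊗_

    q^-⊗-+ : ∀ a f m → (q^ a ⊗ f) (a ℕ.+ m) ≡ f m
    q^-⊗-+ zero    f m = ⊗-identityˡ f m
    q^-⊗-+ (suc a) f m = trans (+-identityˡ _) (q^-⊗-+ a f m)

    q^-⊗-< : ∀ {a m} f → m < a → (q^ a ⊗ f) m ≡ 0ℤ
    q^-⊗-< {suc a} {zero}  f _         = refl
    q^-⊗-< {suc a} {suc m} f (s≤s m<a) = trans (+-identityˡ _) (q^-⊗-< f m<a)

    q^-+ : ∀ a b → q^ a ⊗ q^ b ≈ q^ (a ℕ.+ b)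
    q^-+ zero    b = ⊗-identityˡ (q^ b)
    q^-+ (suc a) b zero    = refl
    q^-+ (suc a) b (suc n) = trans (+-identityˡ _) (q^-+ a b n)

  D-q^ : ∀ a → D (q^ a) ≈ κ (+ a) ⊗ q^ a
  D-q^ a n = trans (coefficient n) (sym (κ-⊗ (+ a) (q^ a) n))
    where
    coefficient : ∀ n → D (q^ a) n ≡ + a * (q^ a) n
    coefficient n with n ≡ᵇ a in eq
    ... | true  = cong (λ k → + k * 1ℤ) (ℕ.≡ᵇ⇒≡ n a (subst T (sym eq) tt))
    ... | false = trans (*-zeroʳ (+ n)) (sym (*-zeroʳ (+ a)))

  -- A series divisible by every power of q vanishes.
  q^-fixpoint : ∀ a X → X ≈ q^ suc a ⊗ X → ∀ n → X n ≡ 0ℤ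
  q^-fixpoint a X X≈ n = below (suc n) n ℕ.≤-refl
    where
    below : ∀ N n → n < N → X n ≡ 0ℤ
    below (suc N) n n<1+N with n ℕ.<? suc a
    ... | yes n<a = trans (X≈ n) (q^-⊗-< X n<a)
    ... | no  n≮a with ℕ.m≤n⇒∃[o]m+o≡n (ℕ.≮⇒≥ n≮a)
    ...   | m , refl = trans (X≈ n) (trans (q^-⊗-+ (suc a) X m)
              (below N m (ℕ.<-≤-trans (s≤s (ℕ.m≤n+m m a)) (ℕ.s≤s⁻¹ n<1+N))))

  -- Takes the place of dividing by 1 - q^(a+1): the difference of two solutions is divisible by
  -- every power of q.
  q^-fixpoint-unique : ∀ a X Y Z → X ≈ Z ⊕ q^ suc a ⊗ X → Y ≈ Z ⊕ q^ suc a ⊗ Y → X ≈ Y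
  q^-fixpoint-unique a X Y Z X≈ Y≈ n = i-j≡0⇒i≡j (X n) (Y n) (q^-fixpoint a (X ⊕ ⊝ Y) fixed n)
    where
    open SeriesSolver
    fixed : X ⊕ ⊝ Y ≈ q^ suc a ⊗ (X ⊕ ⊝ Y)
    fixed = begin
      X ⊕ ⊝ Y                                              ≈⟨ ℛ.+-cong X≈ (ℛ.-‿cong Y≈) ⟩
      (Z ⊕ q^ suc a ⊗ X) ⊕ ⊝ (Z ⊕ q^ suc a ⊗ Y)             ≈⟨ solve 4 (λ A X Y Z → Z :+ A :* X :- (Z :+ A :* Y) :=
               A :* (X :- Y)) ℛ.refl (q^ suc a) X Y Z ⟩
      q^ suc a ⊗ (X ⊕ ⊝ Y)                                  ∎

  -- L a is the expansion of q^a / (1 - q^a).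
  L : ℕ → Series
  L a zero    = 0ℤ
  L a (suc n) = if does (a ∣? suc n) then 1ℤ else 0ℤ

  L-< : ∀ {a n} → n < a → L a n ≡ 0ℤ
  L-< {a} {zero}  _   = refl
  L-< {a} {suc n} n<a = cong (if_then 1ℤ else 0ℤ) (dec-false (a ∣? suc n) (>⇒∤ n<a))

  L-geometric : ∀ a → L (suc a) ≈ q^ suc a ⊗ (κ 1ℤ ⊕ L (suc a))
  L-geometric a n with n ℕ.<? suc a
  ... | yes n<a = trans (L-< n<a) (sym (q^-⊗-< (κ 1ℤ ⊕ L (suc a)) n<a))
  ... | no  n≮a with ℕ.m≤n⇒∃[o]m+o≡n (ℕ.≮⇒≥ n≮a)
  ...   | m , refl = trans (periodic m) (sym (q^-⊗-+ (suc a) (κ 1ℤ ⊕ L (suc a)) m))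
    where
    -- In degree 0 `L` is 0 although every number divides 0; the summand `κ 1ℤ` makes up for this at
    -- m = 0.
    periodic : ∀ m → L (suc a) (suc a ℕ.+ m) ≡ κ 1ℤ m + L (suc a) m
    periodic zero    = cong (if_then 1ℤ else 0ℤ)
      (dec-true (suc a ∣? suc (a ℕ.+ 0)) (subst (suc a ∣_) (sym (ℕ.+-identityʳ (suc a))) ∣-refl))
    periodic (suc m) = trans (cong (if_then 1ℤ else 0ℤ)
      (does-⇔ (mk⇔ (λ d → ∣m+n∣m⇒∣n d ∣-refl) (λ d → ∣m∣n⇒∣m+n ∣-refl d)) (suc a ∣? suc (a ℕ.+ suc m)) (suc a ∣? suc m)))
      (sym (+-identityˡ _))

  -- Both sides are fixed by X ↦ q^(a+b) (1 + L a + L b + X).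
  L-⊗-L : ∀ a b → L (suc a) ⊗ L (suc b) ≈ L (suc a ℕ.+ suc b) ⊗ (κ 1ℤ ⊕ L (suc a) ⊕ L (suc b))
  L-⊗-L a b = q^-fixpoint-unique (a ℕ.+ suc b) _ _ (q^ (suc a ℕ.+ suc b) ⊗ (κ 1ℤ ⊕ L (suc a) ⊕ L (suc b))) left right
    where
    open SeriesSolver
    C = q^ (suc a ℕ.+ suc b)
    x = L (suc a)
    y = L (suc b)
    z = L (suc a ℕ.+ suc b)
    left : x ⊗ y ≈ C ⊗ (κ 1ℤ ⊕ x ⊕ y) ⊕ C ⊗ (x ⊗ y)
    left = begin
      x ⊗ y                                             ≈⟨ ⊗-cong (L-geometric a) (L-geometric b) ⟩
      (q^ suc a ⊗ (κ 1ℤ ⊕ x)) ⊗ (q^ suc b ⊗ (κ 1ℤ ⊕ y))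
        ≈⟨ solve 4 (λ A B x y → (A :* (con 1ℤ :+ x)) :* (B :* (con 1ℤ :+ y)) :=
               (A :* B) :* ((con 1ℤ :+ x) :* (con 1ℤ :+ y))) ℛ.refl (q^ suc a) (q^ suc b) x y ⟩
      (q^ suc a ⊗ q^ suc b) ⊗ ((κ 1ℤ ⊕ x) ⊗ (κ 1ℤ ⊕ y)) ≈⟨ ⊗-congʳ ((κ 1ℤ ⊕ x) ⊗ (κ 1ℤ ⊕ y)) (q^-+ (suc a) (suc b)) ⟩
      C ⊗ ((κ 1ℤ ⊕ x) ⊗ (κ 1ℤ ⊕ y))                     ≈⟨ solve 3 (λ C x y → C :* ((con 1ℤ :+ x) :* (con 1ℤ :+ y)) :=
               C :* (con 1ℤ :+ x :+ y) :+ C :* (x :* y)) ℛ.refl C x y ⟩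
      C ⊗ (κ 1ℤ ⊕ x ⊕ y) ⊕ C ⊗ (x ⊗ y)                    ∎
    right : z ⊗ (κ 1ℤ ⊕ x ⊕ y) ≈ C ⊗ (κ 1ℤ ⊕ x ⊕ y) ⊕ C ⊗ (z ⊗ (κ 1ℤ ⊕ x ⊕ y))
    right = begin
      z ⊗ (κ 1ℤ ⊕ x ⊕ y)                                  ≈⟨ ⊗-congʳ (κ 1ℤ ⊕ x ⊕ y) (L-geometric (a ℕ.+ suc b)) ⟩
      (C ⊗ (κ 1ℤ ⊕ z)) ⊗ (κ 1ℤ ⊕ x ⊕ y)                   ≈⟨ solve 3 (λ C z w → (C :* (con 1ℤ :+ z)) :* w :=
               C :* w :+ C :* (z :* w)) ℛ.refl C z (κ 1ℤ ⊕ x ⊕ y) ⟩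
      C ⊗ (κ 1ℤ ⊕ x ⊕ y) ⊕ C ⊗ (z ⊗ (κ 1ℤ ⊕ x ⊕ y))         ∎

  -- Both sides are fixed by X ↦ a L a + q^a X.
  D-L : ∀ a → D (L (suc a)) ≈ κ (+ suc a) ⊗ (L (suc a) ⊗ L (suc a)) ⊕ κ (+ suc a) ⊗ L (suc a)
  D-L a = q^-fixpoint-unique a _ _ (k ⊗ x) left right
    where
    open SeriesSolver
    k = κ (+ suc a)
    A = q^ suc a
    x = L (suc a)
    D-1⊕ : D (κ 1ℤ ⊕ x) ≈ D x
    D-1⊕ zero    = refl
    D-1⊕ (suc n) = cong (_*_ (+ suc n)) (+-identityˡ (x (suc n)))
    left : D x ≈ k ⊗ x ⊕ A ⊗ D x
    left = begin
      D x                                    ≈⟨ (λ n → cong (_*_ (+ n)) (L-geometric a n)) ⟩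
      D (A ⊗ (κ 1ℤ ⊕ x))                       ≈⟨ D-⊗ A (κ 1ℤ ⊕ x) ⟩
      D A ⊗ (κ 1ℤ ⊕ x) ⊕ A ⊗ D (κ 1ℤ ⊕ x)        ≈⟨ ℛ.+-cong (⊗-congʳ (κ 1ℤ ⊕ x) (D-q^ (suc a))) (⊗-congˡ A D-1⊕) ⟩
      (k ⊗ A) ⊗ (κ 1ℤ ⊕ x) ⊕ A ⊗ D x           ≈⟨ ℛ.+-congʳ (ℛ.*-assoc k A (κ 1ℤ ⊕ x)) ⟩
      k ⊗ (A ⊗ (κ 1ℤ ⊕ x)) ⊕ A ⊗ D x           ≈⟨ ℛ.+-congʳ {A ⊗ D x} (⊗-congˡ k (L-geometric a)) ⟨
      k ⊗ x ⊕ A ⊗ D x                        ∎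
    right : k ⊗ (x ⊗ x) ⊕ k ⊗ x ≈ k ⊗ x ⊕ A ⊗ (k ⊗ (x ⊗ x) ⊕ k ⊗ x)
    right = begin
      k ⊗ (x ⊗ x) ⊕ k ⊗ x                            ≈⟨ ℛ.+-congʳ (⊗-congˡ k (⊗-congˡ x (L-geometric a))) ⟩
      k ⊗ (x ⊗ (A ⊗ (κ 1ℤ ⊕ x))) ⊕ k ⊗ x             ≈⟨ solve 3 (λ k A x → k :* (x :* (A :* (con 1ℤ :+ x))) :+ k :* x :=
               k :* x :+ A :* (k :* (x :* x) :+ k :* x)) ℛ.refl k A x ⟩
      k ⊗ x ⊕ A ⊗ (k ⊗ (x ⊗ x) ⊕ k ⊗ x)              ∎

open GeometricSeries

-- Lambert series and Skoruppa's identity.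

module LambertSeries where
  open import Data.Integer.Base using (_+_; _*_; -_; _-_)
  open import Data.Integer.Properties
  open import Algebra.Properties.AbelianGroup +-0-abelianGroup using () renaming (∙-cancelˡ to +-cancelˡ)
  open ≡-Reasoning
  open +-*-Solver

  Λ[_] : ℕ → (ℕ → ℤ) → Series
  Λ[ N ] w n = ∑ N (λ c → w c * L c n)

  -- The infinite sum ∑ w c · L c over c > 0: in degree n the terms with c > n vanish, so the n-th
  -- partial sum already has the right coefficient.
  Λ : (ℕ → ℤ) → Series
  Λ w n = Λ[ n ] w n

  Λ-partial : ∀ {n N} w → n ≤ N → Λ[ N ] w n ≡ Λ w n
  Λ-partial {n} w n≤N = ∑-truncate _ n≤N
    (λ c n≤c → trans (cong (_*_ (w (suc c))) (L-< (s≤s n≤c))) (*-zeroʳ (w (suc c))))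

  Λ[]-⊗ : ∀ N w g n → (Λ[ N ] w ⊗ g) n ≡ ∑ N (λ c → w c * (L c ⊗ g) n)
  Λ[]-⊗ zero    w g n = trans (⊗-zeroˡ g (sym ∘ κ0) n) (κ0 n)
  Λ[]-⊗ (suc N) w g n = trans (⊗-distribʳ g (Λ[ N ] w) (w (suc N) · L (suc N)) n)
    (cong₂ _+_ (Λ[]-⊗ N w g n) (·-⊗ (w (suc N)) (L (suc N)) g n))

  Λ-⊗-Λ : ∀ u v n → (Λ u ⊗ Λ v) n ≡ square n (λ a b → u a * v b * (L a ⊗ L b) n)
  Λ-⊗-Λ u v n = begin
    (Λ u ⊗ Λ v) n
      ≡⟨ ⊗-cong≤ {g′ = Λ[ n ] v} n (λ m m≤n → sym (Λ-partial u m≤n)) (λ m m≤n → sym (Λ-partial v m≤n)) ⟩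
    (Λ[ n ] u ⊗ Λ[ n ] v) n
      ≡⟨ Λ[]-⊗ n u (Λ[ n ] v) n ⟩
    ∑ n (λ a → u a * (L a ⊗ Λ[ n ] v) n)
      ≡⟨ ∑-cong n (λ a _ → row (suc a)) ⟩
    square n (λ a b → u a * v b * (L a ⊗ L b) n) ∎
    where
    row : ∀ a → u a * (L a ⊗ Λ[ n ] v) n ≡ ∑ n (λ b → u a * v b * (L a ⊗ L b) n)
    row a = begin
      u a * (L a ⊗ Λ[ n ] v) n                    ≡⟨ cong (_*_ (u a)) (⊗-comm (L a) (Λ[ n ] v) n) ⟩
      u a * (Λ[ n ] v ⊗ L a) n                    ≡⟨ cong (_*_ (u a)) (Λ[]-⊗ n v (L a) n) ⟩
      u a * ∑ n (λ b → v b * (L b ⊗ L a) n)       ≡⟨ ∑-*ˡ n (u a) (λ b → v b * (L b ⊗ L a) n) ⟨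
      ∑ n (λ b → u a * (v b * (L b ⊗ L a) n))
        ≡⟨ ∑-cong n (λ b _ → trans (cong (λ x → u a * (v (suc b) * x)) (⊗-comm (L (suc b)) (L a) n)) (sym (*-assoc (u a) (v (suc b)) _))) ⟩
      ∑ n (λ b → u a * v b * (L a ⊗ L b) n)       ∎

  module _ (G : ℤ → ℤ → ℤ) (G-sym : ∀ x y → G x y ≡ G y x) (G-reflect : ∀ x y → G x y ≡ G x (x - y)) where

    -- The 1 in `L-⊗-L` produces the Lambert series on the right. By `G-reflect` the rest, G (c, b)
    -- L c (L a + L b) with c = a + b, splits into two terms of one shape, each of which sums to the
    -- triangle b < c. The diagonal completes the two triangles to the square and is therefore added
    -- on the left.
    skoruppa : ∀ n → square n (λ a b → G (+ (a ℕ.+ b)) (+ b) * (L a ⊗ L b) n) + ∑ n (λ c → G (+ c) (+ c) * (L c ⊗ L c) n)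
                   ≡ Λ (λ c → ∑ (c ∸ 1) (λ b → G (+ c) (+ b))) n + square n (λ a b → G (+ a) (+ b) * (L a ⊗ L b) n)
    skoruppa n = begin
      square n (λ a b → G (+ (a ℕ.+ b)) (+ b) * M a b) + diagonal
        ≡⟨ cong (_+ diagonal) (square-diagonals n (λ a b → G (+ (a ℕ.+ b)) (+ b) * M a b) (λ a b n<a+b → trans (cong (_*_ (G (+ (suc a ℕ.+ suc b)) (+ suc b))) (M-< a b n<a+b)) (*-zeroʳ (G (+ (suc a ℕ.+ suc b)) (+ suc b))))) ⟩
      triangle n (λ c a → G (+ (a ℕ.+ (c ∸ a))) (+ (c ∸ a)) * M a (c ∸ a)) + diagonal
        ≡⟨ cong (_+ diagonal) (triangle-cong n split) ⟩
      triangle n (λ c a → G (+ c) (+ a) * L c n + (χ c a + χ c (c ∸ a))) + diagonal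
        ≡⟨ cong (_+ diagonal) (trans (triangle-+ n (λ c a → G (+ c) (+ a) * L c n) (λ c a → χ c a + χ c (c ∸ a))) (cong₂ _+_ (∑-cong n (λ c _ → ∑-*ʳ c (L (suc c) n) (λ a → G (+ suc c) (+ a)))) (triangle-+ n χ (λ c a → χ c (c ∸ a))))) ⟩
      Λ w n + (triangle n χ + triangle n (λ c a → χ c (c ∸ a))) + diagonal
        ≡⟨ cong (λ t → Λ w n + (triangle n χ + t) + diagonal) (∑-cong n (λ c _ → ∑-reverse c (χ (suc c)))) ⟨
      Λ w n + (triangle n χ + triangle n χ) + diagonal
        ≡⟨ +-assoc (Λ w n) (triangle n χ + triangle n χ) diagonal ⟩
      Λ w n + (triangle n χ + triangle n χ + diagonal)
        ≡⟨ cong (_+_ (Λ w n)) (square-symmetric n χ (λ a b → cong₂ _*_ (G-sym (+ a) (+ b)) (⊗-comm (L a) (L b) n))) ⟨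
      Λ w n + square n χ ∎
      where
      M : ℕ → ℕ → ℤ
      M a b = (L a ⊗ L b) n
      χ : ℕ → ℕ → ℤ
      χ a b = G (+ a) (+ b) * M a b
      w : ℕ → ℤ
      w c = ∑ (c ∸ 1) (λ b → G (+ c) (+ b))
      diagonal = ∑ n (λ c → χ c c)

      -- In `L-⊗-L` the factor `L (a + b)` has no term below degree a + b.
      M-< : ∀ a b → n < suc a ℕ.+ suc b → M (suc a) (suc b) ≡ 0ℤ
      M-< a b n<a+b = trans (L-⊗-L a b n) (trans
        (⊗-cong≤ {g = κ 1ℤ ⊕ L (suc a) ⊕ L (suc b)} n (λ m m≤n → trans (L-< (ℕ.≤-<-trans m≤n n<a+b)) (sym (κ0 m))) (λ _ _ → refl))
        (trans (⊗-zeroˡ (κ 1ℤ ⊕ L (suc a) ⊕ L (suc b)) (λ _ → refl) n) (κ0 n)))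

      M-split : ∀ a b → M (suc a) (suc b) ≡ L (suc a ℕ.+ suc b) n + (M (suc a ℕ.+ suc b) (suc a) + M (suc a ℕ.+ suc b) (suc b))
      M-split a b = trans (L-⊗-L a b n) (SeriesSolver.solve 3
        (λ x y z → z S.:* (S.con 1ℤ S.:+ x S.:+ y) S.:= z S.:+ (z S.:* x S.:+ z S.:* y)) (λ _ → refl) (L (suc a)) (L (suc b)) (L (suc a ℕ.+ suc b)) n)
        where module S = SeriesSolver

      +-∸ : ∀ a b → + suc b ≡ + (suc a ℕ.+ suc b) - + suc a
      +-∸ a b = trans (solve 2 (λ x y → y :=
               x :+ y :- x) refl (+ suc a) (+ suc b)) (cong (_- + suc a) (sym (pos-+ (suc a) (suc b))))

      reflected : ∀ a b → G (+ (suc a ℕ.+ suc b)) (+ suc a) ≡ G (+ (suc a ℕ.+ suc b)) (+ suc b)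
      reflected a b = trans (G-reflect (+ (suc a ℕ.+ suc b)) (+ suc a)) (cong (G (+ (suc a ℕ.+ suc b))) (sym (+-∸ a b)))

      -- c and d stand for a + b and c ∸ a; matching on the two equations removes the truncated
      -- subtraction.
      split-sum : ∀ a b {c d} → suc a ℕ.+ suc b ≡ c → d ≡ suc b →
                  G (+ (suc a ℕ.+ d)) (+ d) * M (suc a) d ≡ G (+ c) (+ suc a) * L c n + (χ c (suc a) + χ c d)
      split-sum a b {c} refl refl = begin
        G (+ c) (+ suc b) * M (suc a) (suc b)
          ≡⟨ cong₂ _*_ (sym (reflected a b)) (M-split a b) ⟩
        G (+ c) (+ suc a) * (L c n + (M c (suc a) + M c (suc b)))
          ≡⟨ solve 4 (λ g x y z → g :* (x :+ (y :+ z)) :=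
                   g :* x :+ (g :* y :+ g :* z)) refl (G (+ c) (+ suc a)) (L c n) (M c (suc a)) (M c (suc b)) ⟩
        G (+ c) (+ suc a) * L c n + (χ c (suc a) + G (+ c) (+ suc a) * M c (suc b))
          ≡⟨ cong (λ g → G (+ c) (+ suc a) * L c n + (χ c (suc a) + g * M c (suc b))) (reflected a b) ⟩
        G (+ c) (+ suc a) * L c n + (χ c (suc a) + χ c (suc b)) ∎

      split : ∀ c a → a < c → c < n → G (+ (suc a ℕ.+ (suc c ∸ suc a))) (+ (suc c ∸ suc a)) * M (suc a) (suc c ∸ suc a)
                                    ≡ G (+ suc c) (+ suc a) * L (suc c) n + (χ (suc c) (suc a) + χ (suc c) (suc c ∸ suc a))
      split c a a<c _ with ℕ.m≤n⇒∃[o]m+o≡n a<c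
      ... | b , 1+a+b≡c = split-sum a b a+b≡c (trans (cong (_∸ suc a) (sym a+b≡c)) (ℕ.m+n∸m≡n (suc a) (suc b)))
        where
        a+b≡c : suc a ℕ.+ suc b ≡ suc c
        a+b≡c = trans (ℕ.+-suc (suc a) b) (cong suc 1+a+b≡c)

    -- Since G (c, c) = e c · c, `D-L` gives ∑ G (c, c) (L c)² = D (Λ e) - ∑ G (c, c) L c. The last
    -- sum is the missing term b = c of the inner sum, which therefore runs to c instead of c - 1.
    skoruppa-difference : (H : ℤ → ℤ → ℤ) (e : ℕ → ℤ) → (∀ x y → G (x + y) y ≡ G x y + H x y) → (∀ c → G (+ c) (+ c) ≡ e c * + c) →
      ∀ n → square n (λ a b → H (+ a) (+ b) * (L a ⊗ L b) n) + D (Λ e) n ≡ Λ (λ c → ∑ c (λ b → G (+ c) (+ b))) n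
    skoruppa-difference H e G-H G-e n = +-cancelˡ (square n χ) _ _ (begin
      square n χ + (square n η + D (Λ e) n)
        ≡⟨ cong (λ x → square n χ + (square n η + x)) derivative ⟩
      square n χ + (square n η + (∑ n (λ c → G (+ c) (+ c) * M c c) + ∑ n (λ c → G (+ c) (+ c) * L c n)))
        ≡⟨ solve 4 (λ a b c d → a :+ (b :+ (c :+ d)) :=
                 a :+ b :+ c :+ d) refl (square n χ) (square n η) (∑ n (λ c → G (+ c) (+ c) * M c c)) (∑ n (λ c → G (+ c) (+ c) * L c n)) ⟩
      square n χ + square n η + ∑ n (λ c → G (+ c) (+ c) * M c c) + ∑ n (λ c → G (+ c) (+ c) * L c n)
        ≡⟨ cong (λ x → x + ∑ n (λ c → G (+ c) (+ c) * M c c) + ∑ n (λ c → G (+ c) (+ c) * L c n)) difference ⟨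
      square n (λ a b → G (+ (a ℕ.+ b)) (+ b) * M a b) + ∑ n (λ c → G (+ c) (+ c) * M c c) + ∑ n (λ c → G (+ c) (+ c) * L c n)
        ≡⟨ cong (_+ ∑ n (λ c → G (+ c) (+ c) * L c n)) (skoruppa n) ⟩
      Λ (λ c → ∑ (c ∸ 1) (λ b → G (+ c) (+ b))) n + square n χ + ∑ n (λ c → G (+ c) (+ c) * L c n)
        ≡⟨ solve 3 (λ a b c → a :+ b :+ c := b :+ (a :+ c)) refl (Λ (λ c → ∑ (c ∸ 1) (λ b → G (+ c) (+ b))) n) (square n χ) _ ⟩
      square n χ + (Λ (λ c → ∑ (c ∸ 1) (λ b → G (+ c) (+ b))) n + ∑ n (λ c → G (+ c) (+ c) * L c n))
        ≡⟨ cong (_+_ (square n χ)) (∑-+ n (λ c → ∑ (c ∸ 1) (λ b → G (+ c) (+ b)) * L c n) (λ c → G (+ c) (+ c) * L c n)) ⟨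
      square n χ + ∑ n (λ c → ∑ (c ∸ 1) (λ b → G (+ c) (+ b)) * L c n + G (+ c) (+ c) * L c n)
        ≡⟨ cong (_+_ (square n χ)) (∑-cong n (λ c _ → sym (*-distribʳ-+ (L (suc c) n) (∑ c (λ b → G (+ suc c) (+ b))) (G (+ suc c) (+ suc c))))) ⟩
      square n χ + Λ (λ c → ∑ c (λ b → G (+ c) (+ b))) n ∎)
      where
      M : ℕ → ℕ → ℤ
      M a b = (L a ⊗ L b) n
      χ η : ℕ → ℕ → ℤ
      χ a b = G (+ a) (+ b) * M a b
      η a b = H (+ a) (+ b) * M a b

      difference : square n (λ a b → G (+ (a ℕ.+ b)) (+ b) * M a b) ≡ square n χ + square n η
      difference = begin
        square n (λ a b → G (+ (a ℕ.+ b)) (+ b) * M a b)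
          ≡⟨ square-cong n (λ a b → cong (_* M (suc a) (suc b)) (trans (cong (λ z → G z (+ suc b)) (pos-+ (suc a) (suc b))) (G-H (+ suc a) (+ suc b)))) ⟩
        square n (λ a b → (G (+ a) (+ b) + H (+ a) (+ b)) * M a b)
          ≡⟨ square-cong n (λ a b → *-distribʳ-+ (M (suc a) (suc b)) (G (+ suc a) (+ suc b)) (H (+ suc a) (+ suc b))) ⟩
        square n (λ a b → χ a b + η a b)
          ≡⟨ square-+ n χ η ⟩
        square n χ + square n η ∎

      D-L′ : ∀ c → + n * L (suc c) n ≡ + suc c * M (suc c) (suc c) + + suc c * L (suc c) n
      D-L′ c = trans (D-L c n) (cong₂ _+_ (κ-⊗ (+ suc c) (L (suc c) ⊗ L (suc c)) n) (κ-⊗ (+ suc c) (L (suc c)) n))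

      derivative : D (Λ e) n ≡ ∑ n (λ c → G (+ c) (+ c) * M c c) + ∑ n (λ c → G (+ c) (+ c) * L c n)
      derivative = begin
        + n * ∑ n (λ c → e c * L c n)
          ≡⟨ ∑-*ˡ n (+ n) (λ c → e c * L c n) ⟨
        ∑ n (λ c → + n * (e c * L c n))
          ≡⟨ ∑-cong n (λ c _ → term (suc c) (D-L′ c)) ⟩
        ∑ n (λ c → G (+ c) (+ c) * M c c + G (+ c) (+ c) * L c n)
          ≡⟨ ∑-+ n (λ c → G (+ c) (+ c) * M c c) (λ c → G (+ c) (+ c) * L c n) ⟩
        _ ∎
        where
        term : ∀ c → + n * L c n ≡ + c * M c c + + c * L c n → + n * (e c * L c n) ≡ G (+ c) (+ c) * M c c + G (+ c) (+ c) * L c n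
        term c D-Lc = begin
          + n * (e c * L c n)                            ≡⟨ solve 3 (λ n e x → n :* (e :* x) :=
                   e :* (n :* x)) refl (+ n) (e c) (L c n) ⟩
          e c * (+ n * L c n)                            ≡⟨ cong (_*_ (e c)) D-Lc ⟩
          e c * (+ c * M c c + + c * L c n)              ≡⟨ solve 4 (λ e c m x → e :* (c :* m :+ c :* x) :=
                   e :* c :* m :+ e :* c :* x) refl (e c) (+ c) (M c c) (L c n) ⟩
          e c * + c * M c c + e c * + c * L c n          ≡⟨ cong₂ (λ x y → x * M c c + y * L c n) (G-e c) (G-e c) ⟨
          G (+ c) (+ c) * M c c + G (+ c) (+ c) * L c n  ∎

open LambertSeries

-- Convolutions of divisor sums from invariant polynomials.

module DivisorConvolutions where
  open import Data.Integer.Base using (_+_; _*_; -_; _-_)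
  open import Data.Integer.Properties

  infixl 7 _⊙_

  -- Multiplication on ℤ unfolds even on variables, which makes the conversion
  -- checks behind the polynomial identities below exponential; hence an opaque
  -- copy here as well.
  opaque
    _⊙_ : ℤ → ℤ → ℤ
    _⊙_ = _*_

    ⊙≡* : ∀ x y → x ⊙ y ≡ x * y
    ⊙≡* x y = refl

    ⊙-isCommutativeRing : IsCommutativeRing _≡_ _+_ _⊙_ -_ 0ℤ 1ℤ
    ⊙-isCommutativeRing = +-*-isCommutativeRing

  ⊙-ring : CommutativeRing 0ℓ 0ℓ
  ⊙-ring = record { isCommutativeRing = ⊙-isCommutativeRing }

  ⊙-hom : CommutativeRing.rawRing +-*-commutativeRing -Raw-AlmostCommutative⟶ fromCommutativeRing ⊙-ring
  ⊙-hom = record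
    { ⟦_⟧ = λ z → z ; +-homo = λ _ _ → refl ; *-homo = λ x y → sym (⊙≡* x y) ; -‿homo = λ _ → refl ; 0-homo = refl ; 1-homo = refl }

  module PolynomialSolver = Algebra.Solver.Ring
    (CommutativeRing.rawRing +-*-commutativeRing) (fromCommutativeRing ⊙-ring) ⊙-hom (dec⇒weaklyDec _≟_)

  open Algebra.Properties.Semiring.Exp (CommutativeRing.semiring ⊙-ring) using () renaming (_^_ to _^⊙_) public

  pos-^ : ∀ c k → (+ c) ^⊙ k ≡ + (c ℕ.^ k)
  pos-^ c zero    = refl
  pos-^ c (suc k) = trans (⊙≡* (+ c) _) (trans (cong (_*_ (+ c)) (pos-^ c k)) (sym (pos-* c (c ℕ.^ k))))

  Λ-cong : ∀ {u v} → (∀ c → u c ≡ v c) → Λ u ≈ Λ v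
  Λ-cong u≡v n = ∑-cong n (λ c _ → cong (_* L (suc c) n) (u≡v (suc c)))

  Λ-+ : ∀ u v → Λ (λ c → u c + v c) ≈ Λ u ⊕ Λ v
  Λ-+ u v n = trans (∑-cong n (λ c _ → *-distribʳ-+ (L (suc c) n) (u (suc c)) (v (suc c))))
    (∑-+ n (λ c → u c * L c n) (λ c → v c * L c n))

  Λ-* : ∀ z u → Λ (λ c → z ⊙ u c) ≈ κ z ⊗ Λ u
  Λ-* z u n = trans (∑-cong n (λ c _ → trans (cong (_* L (suc c) n) (⊙≡* z (u (suc c)))) (*-assoc z (u (suc c)) (L (suc c) n))))
    (trans (∑-*ˡ n z (λ c → u c * L c n)) (sym (κ-⊗ z (Λ u) n)))

  Λ₂ : (ℤ → ℤ → ℤ) → Series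
  Λ₂ H n = square n (λ a b → H (+ a) (+ b) * (L a ⊗ L b) n)

  Λ₂-+ : ∀ H H′ → Λ₂ (λ x y → H x y + H′ x y) ≈ Λ₂ H ⊕ Λ₂ H′
  Λ₂-+ H H′ n = trans
    (square-cong n (λ a b → *-distribʳ-+ ((L (suc a) ⊗ L (suc b)) n) (H (+ suc a) (+ suc b)) (H′ (+ suc a) (+ suc b))))
    (square-+ n (λ a b → H (+ a) (+ b) * (L a ⊗ L b) n) (λ a b → H′ (+ a) (+ b) * (L a ⊗ L b) n))

  -- s k is the generating series of the divisor sums σ k.
  s : ℕ → Series
  s k = Λ (λ c → + (c ℕ.^ k))

  Λ-monomial : ∀ z k → Λ (λ c → z ⊙ (+ c) ^⊙ k) ≈ κ z ⊗ s k
  Λ-monomial z k n = trans (Λ-cong (λ c → cong (_⊙_ z) (pos-^ c k)) n) (Λ-* z (λ c → + (c ℕ.^ k)) n)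

  D-monomial : ∀ z k → D (Λ (λ c → z ⊙ (+ c) ^⊙ k)) ≈ κ z ⊗ D (s k)
  D-monomial z k n = trans (D-cong (Λ-monomial z k) n) (D-κ⊗ z (s k) n)

  Λ₂-monomial : ∀ z k l → Λ₂ (λ x y → z ⊙ (x ^⊙ k ⊙ y ^⊙ l)) ≈ κ z ⊗ (s k ⊗ s l)
  Λ₂-monomial z k l n = begin
    square n (λ a b → (z ⊙ ((+ a) ^⊙ k ⊙ (+ b) ^⊙ l)) * (L a ⊗ L b) n)
      ≡⟨ square-cong n (λ a b → trans (cong (_* (L (suc a) ⊗ L (suc b)) n) (monomial (suc a) (suc b))) (*-assoc z _ _)) ⟩
    square n (λ a b → z * (+ (a ℕ.^ k) * + (b ℕ.^ l) * (L a ⊗ L b) n))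
      ≡⟨ square-*ˡ n z (λ a b → + (a ℕ.^ k) * + (b ℕ.^ l) * (L a ⊗ L b) n) ⟩
    z * square n (λ a b → + (a ℕ.^ k) * + (b ℕ.^ l) * (L a ⊗ L b) n)
      ≡⟨ cong (_*_ z) (Λ-⊗-Λ (λ c → + (c ℕ.^ k)) (λ c → + (c ℕ.^ l)) n) ⟨
    z * (s k ⊗ s l) n
      ≡⟨ κ-⊗ z (s k ⊗ s l) n ⟨
    (κ z ⊗ (s k ⊗ s l)) n ∎
    where
    open ≡-Reasoning
    monomial : ∀ a b → z ⊙ ((+ a) ^⊙ k ⊙ (+ b) ^⊙ l) ≡ z * (+ (a ℕ.^ k) * + (b ℕ.^ l))
    monomial a b = trans (⊙≡* z _) (cong (_*_ z) (trans (⊙≡* _ _) (cong₂ _*_ (pos-^ a k) (pos-^ b l))))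

  ∑-telescope : ∀ z (φ F : ℕ → ℤ) → F 0 ≡ 0ℤ → (∀ m → F m + z ⊙ φ (suc m) ≡ F (suc m)) → ∀ n → z * ∑ n φ ≡ F n
  ∑-telescope z φ F F0 F+ zero    = trans (*-zeroʳ z) (sym F0)
  ∑-telescope z φ F F0 F+ (suc n) = trans (*-distribˡ-+ z (∑ n φ) (φ (suc n)))
    (trans (cong₂ _+_ (∑-telescope z φ F F0 F+ n) (sym (⊙≡* z (φ (suc n))))) (F+ n))

  -- `F0` and `F+` certify F x y as the closed form of z times the sum of G (x, b) over 0 < b ≤ y,
  -- so that no summation is left in the hypotheses.
  convolution-identity : ∀ z (G H F : ℤ → ℤ → ℤ) (e : ℕ → ℤ) →
    (∀ x y → G x y ≡ G y x) → (∀ x y → G x y ≡ G x (x - y)) →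
    (∀ x y → G (x + y) y ≡ G x y + H x y) → (∀ c → G (+ c) (+ c) ≡ e c ⊙ + c) →
    (∀ x → F x 0ℤ ≡ 0ℤ) → (∀ x y → F x y + z ⊙ G x (1ℤ + y) ≡ F x (1ℤ + y)) →
    κ z ⊗ (Λ₂ H ⊕ D (Λ e)) ≈ Λ (λ c → F (+ c) (+ c))
  convolution-identity z G H F e G-sym G-reflect G-H G-e F0 F+ n = begin
    (κ z ⊗ (Λ₂ H ⊕ D (Λ e))) n                        ≡⟨ κ-⊗ z (Λ₂ H ⊕ D (Λ e)) n ⟩
    z * (Λ₂ H n + D (Λ e) n)
      ≡⟨ cong (_*_ z) (skoruppa-difference G G-sym G-reflect H e G-H (λ c → trans (G-e c) (⊙≡* (e c) (+ c))) n) ⟩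
    z * Λ w n                                         ≡⟨ κ-⊗ z (Λ w) n ⟨
    (κ z ⊗ Λ w) n                                     ≡⟨ Λ-* z w n ⟨
    Λ (λ c → z ⊙ w c) n
      ≡⟨ Λ-cong (λ c → trans (⊙≡* z (w c)) (∑-telescope z (λ b → G (+ c) (+ b)) (λ b → F (+ c) (+ b)) (F0 (+ c)) (λ m → F+ (+ c) (+ m)) c)) n ⟩
    Λ (λ c → F (+ c) (+ c)) n                         ∎
    where
    open ≡-Reasoning
    w : ℕ → ℤ
    w c = ∑ c (λ b → G (+ c) (+ b))

  open PolynomialSolver

  -- Polynomials in two variables are kept as solver expressions, so that the
  -- solver sees through ⟪_⟫.
  Polynomial₂ : Set
  Polynomial₂ = ∀ {n} → Polynomial n → Polynomial n → Polynomial n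

  ⟪_⟫ : Polynomial₂ → ℤ → ℤ → ℤ
  ⟪ p ⟫ x y = ⟦ p {2} (var zero) (var (suc zero)) ⟧ (x ∷ y ∷ [])

  -- The symmetries (x, y) ↦ (y, x) and (x, y) ↦ (x, x - y) generate a dihedral group of order 12.
  -- Its rational polynomial invariants are generated by `norm` and the square of `cross`, of
  -- degrees 2 and 6; `cross` itself changes sign under the swap.
  norm : Polynomial₂
  norm x y = x :* x :- x :* y :+ y :* y

  cross : Polynomial₂
  cross x y = x :* y :* (x :- y)

  -- z times the sum of G (c, b) over 0 < b ≤ m, for the G of the same index: each bracket is an
  -- integer multiple of a power sum by Faulhaber's formula, and z = 6, 30, 2, 420 clears the
  -- denominators. The bound m is kept apart from c because the sum telescopes in m for fixed c.
  F₂ F₄ F₆ F₈ : Polynomial₂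
  F₂ c m = con (+ 2) :* m :^ 3 :+ con (+ 3) :* m :^ 2 :+ m
        :+ c :* (con (- + 3) :* m :^ 2 :- con (+ 3) :* m)
        :+ c :^ 2 :* (con (+ 6) :* m)
  F₄ c m = con (+ 6) :* m :^ 5 :+ con (+ 15) :* m :^ 4 :+ con (+ 10) :* m :^ 3 :- m
        :+ c :* (con (- + 15) :* m :^ 4 :- con (+ 30) :* m :^ 3 :- con (+ 15) :* m :^ 2)
        :+ c :^ 2 :* (con (+ 30) :* m :^ 3 :+ con (+ 45) :* m :^ 2 :+ con (+ 15) :* m)
        :+ c :^ 3 :* (con (- + 30) :* m :^ 2 :- con (+ 30) :* m)
        :+ c :^ 4 :* (con (+ 30) :* m)
  F₆ c m = con (+ 12) :* m :^ 7 :+ con (+ 42) :* m :^ 6 :+ con (+ 42) :* m :^ 5 :- con (+ 14) :* m :^ 3 :+ con (+ 2) :* m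
        :+ c :* (con (- + 42) :* m :^ 6 :- con (+ 126) :* m :^ 5 :- con (+ 105) :* m :^ 4 :+ con (+ 21) :* m :^ 2)
        :+ c :^ 2 :* (con (- + 198) :* m :^ 5 :- con (+ 495) :* m :^ 4 :- con (+ 330) :* m :^ 3 :+ con (+ 33) :* m)
        :+ c :^ 3 :* (con (+ 600) :* m :^ 4 :+ con (+ 1200) :* m :^ 3 :+ con (+ 600) :* m :^ 2)
        :+ c :^ 4 :* (con (- + 330) :* m :^ 3 :- con (+ 495) :* m :^ 2 :- con (+ 165) :* m)
        :+ c :^ 5 :* (con (- + 126) :* m :^ 2 :- con (+ 126) :* m)
        :+ c :^ 6 :* (con (+ 84) :* m)
  F₈ c m = c :^ 2 :* (con (+ 60) :* m :^ 7 :+ con (+ 210) :* m :^ 6 :+ con (+ 210) :* m :^ 5 :- con (+ 70) :* m :^ 3 :+ con (+ 10) :* m)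
        :+ c :^ 3 :* (con (- + 210) :* m :^ 6 :- con (+ 630) :* m :^ 5 :- con (+ 525) :* m :^ 4 :+ con (+ 105) :* m :^ 2)
        :+ c :^ 4 :* (con (+ 336) :* m :^ 5 :+ con (+ 840) :* m :^ 4 :+ con (+ 560) :* m :^ 3 :- con (+ 56) :* m)
        :+ c :^ 5 :* (con (- + 315) :* m :^ 4 :- con (+ 630) :* m :^ 3 :- con (+ 315) :* m :^ 2)
        :+ c :^ 6 :* (con (+ 140) :* m :^ 3 :+ con (+ 210) :* m :^ 2 :+ con (+ 70) :* m)

  -- The constants in G₆ are chosen such that c⁷ cancels in F₆ (c, c), so that σ₇
  -- does not occur.
  G₂ G₄ G₆ G₈ : Polynomial₂
  G₂ = norm
  G₄ x y = norm x y :^ 2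
  G₆ x y = con (+ 42) :* norm x y :^ 3 :- con (+ 747) :* cross x y :^ 2
  G₈ x y = cross x y :^ 2 :* norm x y

  monomial : ℤ → ℕ → ℕ → Polynomial₂
  monomial z k l x y = con z :* (x :^ k :* y :^ l)

  odd : ℤ → ℕ → ℤ → ℕ → ℤ → ℕ → ∀ {n} → Polynomial n → Polynomial n
  odd t p u q v r x = con t :* x :^ p :+ con u :* x :^ q :+ con v :* x :^ r

  -- α, β, δ and t, u, v are the coefficients found by expanding
  -- G (x + y, y) - G (x, y), G (c, c) / c and z ∑_{b ≤ c} G (c, b) respectively.
  divisor-convolution : ∀ z (G F : ℤ → ℤ → ℤ) α k l β m δ j t p u q v r →
    (∀ x y → G x y ≡ G y x) → (∀ x y → G x y ≡ G x (x - y)) →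
    (∀ x y → G (x + y) y ≡ G x y + (α ⊙ (x ^⊙ k ⊙ y ^⊙ l) + α ⊙ (x ^⊙ l ⊙ y ^⊙ k) + β ⊙ (x ^⊙ m ⊙ y ^⊙ m))) →
    (∀ x → G x x ≡ δ ⊙ x ^⊙ j ⊙ x) →
    (∀ x → F x 0ℤ ≡ 0ℤ) → (∀ x y → F x y + z ⊙ G x (1ℤ + y) ≡ F x (1ℤ + y)) →
    (∀ x → F x x ≡ t ⊙ x ^⊙ p + u ⊙ x ^⊙ q + v ⊙ x ^⊙ r) →
    κ z ⊗ (κ α ⊗ (s k ⊗ s l) ⊕ κ α ⊗ (s l ⊗ s k) ⊕ κ β ⊗ (s m ⊗ s m) ⊕ κ δ ⊗ D (s j))
    ≈ κ t ⊗ s p ⊕ κ u ⊗ s q ⊕ κ v ⊗ s r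
  divisor-convolution z G F α k l β m δ j t p u q v r G-sym G-reflect G-H G-e F0 F+ F-diagonal = begin
    κ z ⊗ (κ α ⊗ (s k ⊗ s l) ⊕ κ α ⊗ (s l ⊗ s k) ⊕ κ β ⊗ (s m ⊗ s m) ⊕ κ δ ⊗ D (s j))
      ≈⟨ ⊗-congˡ (κ z) (λ n → cong₂ _+_ (cong₂ _+_ (cong₂ _+_ (Λ₂-monomial α k l n) (Λ₂-monomial α l k n)) (Λ₂-monomial β m m n)) (D-monomial δ j n)) ⟨
    κ z ⊗ (Λ₂ H₁ ⊕ Λ₂ H₂ ⊕ Λ₂ H₃ ⊕ D (Λ (λ c → δ ⊙ (+ c) ^⊙ j)))
      ≈⟨ ⊗-congˡ (κ z) (λ n → cong (_+ D (Λ (λ c → δ ⊙ (+ c) ^⊙ j)) n) (trans (Λ₂-+ (λ x y → H₁ x y + H₂ x y) H₃ n) (cong (_+ Λ₂ H₃ n) (Λ₂-+ H₁ H₂ n)))) ⟨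
    κ z ⊗ (Λ₂ (λ x y → H₁ x y + H₂ x y + H₃ x y) ⊕ D (Λ (λ c → δ ⊙ (+ c) ^⊙ j)))
      ≈⟨ convolution-identity z G (λ x y → H₁ x y + H₂ x y + H₃ x y) F (λ c → δ ⊙ (+ c) ^⊙ j) G-sym G-reflect G-H (λ c → G-e (+ c)) F0 F+ ⟩
    Λ (λ c → F (+ c) (+ c))
      ≈⟨ Λ-cong (λ c → F-diagonal (+ c)) ⟩
    Λ (λ c → t ⊙ (+ c) ^⊙ p + u ⊙ (+ c) ^⊙ q + v ⊙ (+ c) ^⊙ r)
      ≈⟨ (λ n → trans (Λ-+ (λ c → t ⊙ (+ c) ^⊙ p + u ⊙ (+ c) ^⊙ q) (λ c → v ⊙ (+ c) ^⊙ r) n) (cong₂ _+_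
           (trans (Λ-+ (λ c → t ⊙ (+ c) ^⊙ p) (λ c → u ⊙ (+ c) ^⊙ q) n) (cong₂ _+_ (Λ-monomial t p n) (Λ-monomial u q n)))
           (Λ-monomial v r n))) ⟩
    κ t ⊗ s p ⊕ κ u ⊗ s q ⊕ κ v ⊗ s r ∎
    where
    open import Relation.Binary.Reasoning.Setoid ℛ.setoid
    H₁ H₂ H₃ : ℤ → ℤ → ℤ
    H₁ x y = α ⊙ (x ^⊙ k ⊙ y ^⊙ l)
    H₂ x y = α ⊙ (x ^⊙ l ⊙ y ^⊙ k)
    H₃ x y = β ⊙ (x ^⊙ m ⊙ y ^⊙ m)

  -- `norm` at (x + y, y) is x² + x y + y², which exceeds `norm` at (x, y) by 2 x y; hence the two
  -- equal products. Terms with coefficient 0, here and below, pad the identity to the shape of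
  -- `divisor-convolution`.
  s₁-⊗-s₁ : κ (+ 6) ⊗ (κ (+ 1) ⊗ (s 1 ⊗ s 1) ⊕ κ (+ 1) ⊗ (s 1 ⊗ s 1) ⊕ κ (+ 0) ⊗ (s 3 ⊗ s 3) ⊕ κ (+ 1) ⊗ D (s 1))
    ≈ κ (+ 5) ⊗ s 3 ⊕ κ (+ 1) ⊗ s 1 ⊕ κ (+ 0) ⊗ s 1
  s₁-⊗-s₁ = divisor-convolution (+ 6) ⟪ G₂ ⟫ ⟪ F₂ ⟫ (+ 1) 1 1 (+ 0) 3 (+ 1) 1 (+ 5) 3 (+ 1) 1 (+ 0) 1
    (solve 2 (λ x y → G₂ x y := G₂ y x) refl)
    (solve 2 (λ x y → G₂ x y := G₂ x (x :- y)) refl)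
    (solve 2 (λ x y → G₂ (x :+ y) y :=
             G₂ x y :+ (monomial (+ 1) 1 1 x y :+ monomial (+ 1) 1 1 x y :+ monomial (+ 0) 3 3 x y)) refl)
    (solve 1 (λ x → G₂ x x := con (+ 1) :* x :^ 1 :* x) refl)
    (solve 1 (λ x → F₂ x (con 0ℤ) := con 0ℤ) refl)
    (solve 2 (λ x y → F₂ x y :+ con (+ 6) :* G₂ x (con 1ℤ :+ y) := F₂ x (con 1ℤ :+ y)) refl)
    (solve 1 (λ x → F₂ x x := odd (+ 5) 3 (+ 1) 1 (+ 0) 1 x) refl)

  s₁-⊗-s₃ : κ (+ 30) ⊗ (κ (+ 4) ⊗ (s 1 ⊗ s 3) ⊕ κ (+ 4) ⊗ (s 3 ⊗ s 1) ⊕ κ (+ 0) ⊗ (s 3 ⊗ s 3) ⊕ κ (+ 1) ⊗ D (s 3))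
    ≈ κ (+ 21) ⊗ s 5 ⊕ κ (+ 10) ⊗ s 3 ⊕ κ (- + 1) ⊗ s 1
  s₁-⊗-s₃ = divisor-convolution (+ 30) ⟪ G₄ ⟫ ⟪ F₄ ⟫ (+ 4) 1 3 (+ 0) 3 (+ 1) 3 (+ 21) 5 (+ 10) 3 (- + 1) 1
    (solve 2 (λ x y → G₄ x y := G₄ y x) refl)
    (solve 2 (λ x y → G₄ x y := G₄ x (x :- y)) refl)
    (solve 2 (λ x y → G₄ (x :+ y) y :=
             G₄ x y :+ (monomial (+ 4) 1 3 x y :+ monomial (+ 4) 3 1 x y :+ monomial (+ 0) 3 3 x y)) refl)
    (solve 1 (λ x → G₄ x x := con (+ 1) :* x :^ 3 :* x) refl)
    (solve 1 (λ x → F₄ x (con 0ℤ) := con 0ℤ) refl)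
    (solve 2 (λ x y → F₄ x y :+ con (+ 30) :* G₄ x (con 1ℤ :+ y) := F₄ x (con 1ℤ :+ y)) refl)
    (solve 1 (λ x → F₄ x x := odd (+ 21) 5 (+ 10) 3 (- + 1) 1 x) refl)

  s₁-⊗-s₅ : κ (+ 2) ⊗ (κ (+ 252) ⊗ (s 1 ⊗ s 5) ⊕ κ (+ 252) ⊗ (s 5 ⊗ s 1) ⊕ κ (- + 2400) ⊗ (s 3 ⊗ s 3) ⊕ κ (+ 42) ⊗ D (s 5))
    ≈ κ (+ 42) ⊗ s 5 ⊕ κ (+ 40) ⊗ s 3 ⊕ κ (+ 2) ⊗ s 1
  s₁-⊗-s₅ = divisor-convolution (+ 2) ⟪ G₆ ⟫ ⟪ F₆ ⟫ (+ 252) 1 5 (- + 2400) 3 (+ 42) 5 (+ 42) 5 (+ 40) 3 (+ 2) 1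
    (solve 2 (λ x y → G₆ x y := G₆ y x) refl)
    (solve 2 (λ x y → G₆ x y := G₆ x (x :- y)) refl)
    (solve 2 (λ x y → G₆ (x :+ y) y :=
             G₆ x y :+ (monomial (+ 252) 1 5 x y :+ monomial (+ 252) 5 1 x y :+ monomial (- + 2400) 3 3 x y)) refl)
    (solve 1 (λ x → G₆ x x := con (+ 42) :* x :^ 5 :* x) refl)
    (solve 1 (λ x → F₆ x (con 0ℤ) := con 0ℤ) refl)
    (solve 2 (λ x y → F₆ x y :+ con (+ 2) :* G₆ x (con 1ℤ :+ y) := F₆ x (con 1ℤ :+ y)) refl)
    (solve 1 (λ x → F₆ x x := odd (+ 42) 5 (+ 40) 3 (+ 2) 1 x) refl)

  -- `cross` contains the factor x - y, so `G₈` vanishes on the diagonal and no derivative survives.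
  -- The fourth power of `norm` would also bring in the product of `s 1` and `s 7`.
  s₃-⊗-s₅ : κ (+ 420) ⊗ (κ (+ 6) ⊗ (s 3 ⊗ s 5) ⊕ κ (+ 6) ⊗ (s 5 ⊗ s 3) ⊕ κ (+ 0) ⊗ (s 3 ⊗ s 3) ⊕ κ (+ 0) ⊗ D (s 7))
    ≈ κ (+ 11) ⊗ s 9 ⊕ κ (- + 21) ⊗ s 5 ⊕ κ (+ 10) ⊗ s 3
  s₃-⊗-s₅ = divisor-convolution (+ 420) ⟪ G₈ ⟫ ⟪ F₈ ⟫ (+ 6) 3 5 (+ 0) 3 (+ 0) 7 (+ 11) 9 (- + 21) 5 (+ 10) 3
    (solve 2 (λ x y → G₈ x y := G₈ y x) refl)
    (solve 2 (λ x y → G₈ x y := G₈ x (x :- y)) refl)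
    (solve 2 (λ x y → G₈ (x :+ y) y :=
             G₈ x y :+ (monomial (+ 6) 3 5 x y :+ monomial (+ 6) 5 3 x y :+ monomial (+ 0) 3 3 x y)) refl)
    (solve 1 (λ x → G₈ x x := con (+ 0) :* x :^ 7 :* x) refl)
    (solve 1 (λ x → F₈ x (con 0ℤ) := con 0ℤ) refl)
    (solve 2 (λ x y → F₈ x y :+ con (+ 420) :* G₈ x (con 1ℤ :+ y) := F₈ x (con 1ℤ :+ y)) refl)
    (solve 1 (λ x → F₈ x x := odd (+ 11) 9 (- + 21) 5 (+ 10) 3 x) refl)

open DivisorConvolutions

-- Ramanujan's differential equations and their consequences.

module Ramanujan where
  open import Data.Integer.Base using (_+_; _*_; -_; _-_)
  open import Data.Integer.Properties
  open SeriesSolver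
  open import Relation.Binary.Reasoning.Setoid ℛ.setoid

  D-affine : ∀ x z f → D (κ x ⊕ κ z ⊗ f) ≈ κ z ⊗ D f
  D-affine x z f n = trans (D-⊕ (κ x) (κ z ⊗ f) n) (trans (cong₂ _+_ (trans (D-κ x n) (κ0 n)) (D-κ⊗ z f n)) (+-identityˡ ((κ z ⊗ D f) n)))

  -- Ramanujan's P, Q, R, the Eisenstein series of weights 2, 4, 6.
  P Q R : Series
  P = κ 1ℤ ⊕ κ (- + 24) ⊗ s 1
  Q = κ 1ℤ ⊕ κ (+ 240) ⊗ s 3
  R = κ 1ℤ ⊕ κ (- + 504) ⊗ s 5

  12DP : κ (+ 12) ⊗ D P ≈ P ⊗ P ⊕ ⊝ Q
  12DP = begin
    κ (+ 12) ⊗ D P                            ≈⟨ ⊗-congˡ (κ (+ 12)) (D-affine 1ℤ (- + 24) (s 1)) ⟩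
    κ (+ 12) ⊗ (κ (- + 24) ⊗ D (s 1))
      ≈⟨ solve 3 (λ x y x′ → con (+ 12) :* (con (- + 24) :* x′) :=
           -- The outer factor is fixed by the derivative, -48 · 6 = 12 · (-24), and the square of
           -- `s 1` that it brings in is compensated outside. In the next two proofs likewise 24 ·
           -- 30 = 3 · 240 and -12 · 2 · 42 = 2 · (-504).
           con (- + 48) :* (con (+ 6) :* (con (+ 1) :* (x :* x) :+ con (+ 1) :* (x :* x) :+ con 0ℤ :* (y :* y) :+ con (+ 1) :* x′)) :+ con (+ 576) :* (x :* x)) ℛ.refl (s 1) (s 3) (D (s 1)) ⟩
    κ (- + 48) ⊗ (κ (+ 6) ⊗ (κ (+ 1) ⊗ (s 1 ⊗ s 1) ⊕ κ (+ 1) ⊗ (s 1 ⊗ s 1) ⊕ κ (+ 0) ⊗ (s 3 ⊗ s 3) ⊕ κ (+ 1) ⊗ D (s 1))) ⊕ κ (+ 576) ⊗ (s 1 ⊗ s 1)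
      ≈⟨ ℛ.+-congʳ (⊗-congˡ (κ (- + 48)) s₁-⊗-s₁) ⟩
    κ (- + 48) ⊗ (κ (+ 5) ⊗ s 3 ⊕ κ (+ 1) ⊗ s 1 ⊕ κ (+ 0) ⊗ s 1) ⊕ κ (+ 576) ⊗ (s 1 ⊗ s 1)
      ≈⟨ solve 2 (λ x y → con (- + 48) :* (con (+ 5) :* y :+ con (+ 1) :* x :+ con 0ℤ :* x) :+ con (+ 576) :* (x :* x) :=
           (con 1ℤ :+ con (- + 24) :* x) :* (con 1ℤ :+ con (- + 24) :* x) :- (con 1ℤ :+ con (+ 240) :* y)) ℛ.refl (s 1) (s 3) ⟩
    P ⊗ P ⊕ ⊝ Q                               ∎

  3DQ : κ (+ 3) ⊗ D Q ≈ P ⊗ Q ⊕ ⊝ R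
  3DQ = begin
    κ (+ 3) ⊗ D Q                             ≈⟨ ⊗-congˡ (κ (+ 3)) (D-affine 1ℤ (+ 240) (s 3)) ⟩
    κ (+ 3) ⊗ (κ (+ 240) ⊗ D (s 3))
      ≈⟨ solve 3 (λ x y y′ → con (+ 3) :* (con (+ 240) :* y′) :=
           con (+ 24) :* (con (+ 30) :* (con (+ 4) :* (x :* y) :+ con (+ 4) :* (y :* x) :+ con 0ℤ :* (y :* y) :+ con (+ 1) :* y′)) :- con (+ 5760) :* (x :* y)) ℛ.refl (s 1) (s 3) (D (s 3)) ⟩
    κ (+ 24) ⊗ (κ (+ 30) ⊗ (κ (+ 4) ⊗ (s 1 ⊗ s 3) ⊕ κ (+ 4) ⊗ (s 3 ⊗ s 1) ⊕ κ (+ 0) ⊗ (s 3 ⊗ s 3) ⊕ κ (+ 1) ⊗ D (s 3))) ⊕ ⊝ (κ (+ 5760) ⊗ (s 1 ⊗ s 3))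
      ≈⟨ ℛ.+-congʳ (⊗-congˡ (κ (+ 24)) s₁-⊗-s₃) ⟩
    κ (+ 24) ⊗ (κ (+ 21) ⊗ s 5 ⊕ κ (+ 10) ⊗ s 3 ⊕ κ (- + 1) ⊗ s 1) ⊕ ⊝ (κ (+ 5760) ⊗ (s 1 ⊗ s 3))
      ≈⟨ solve 3 (λ x y z → con (+ 24) :* (con (+ 21) :* z :+ con (+ 10) :* y :+ con (- + 1) :* x) :- con (+ 5760) :* (x :* y) :=
           (con 1ℤ :+ con (- + 24) :* x) :* (con 1ℤ :+ con (+ 240) :* y) :- (con 1ℤ :+ con (- + 504) :* z)) ℛ.refl (s 1) (s 3) (s 5) ⟩
    P ⊗ Q ⊕ ⊝ R                               ∎

  2DR : κ (+ 2) ⊗ D R ≈ P ⊗ R ⊕ ⊝ (Q ⊗ Q)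
  2DR = begin
    κ (+ 2) ⊗ D R                             ≈⟨ ⊗-congˡ (κ (+ 2)) (D-affine 1ℤ (- + 504) (s 5)) ⟩
    κ (+ 2) ⊗ (κ (- + 504) ⊗ D (s 5))
      ≈⟨ solve 4 (λ x y z z′ → con (+ 2) :* (con (- + 504) :* z′) :=
           con (- + 12) :* (con (+ 2) :* (con (+ 252) :* (x :* z) :+ con (+ 252) :* (z :* x) :+ con (- + 2400) :* (y :* y) :+ con (+ 42) :* z′)) :+ (con (+ 12096) :* (x :* z) :- con (+ 57600) :* (y :* y))) ℛ.refl (s 1) (s 3) (s 5) (D (s 5)) ⟩
    κ (- + 12) ⊗ (κ (+ 2) ⊗ (κ (+ 252) ⊗ (s 1 ⊗ s 5) ⊕ κ (+ 252) ⊗ (s 5 ⊗ s 1) ⊕ κ (- + 2400) ⊗ (s 3 ⊗ s 3) ⊕ κ (+ 42) ⊗ D (s 5))) ⊕ (κ (+ 12096) ⊗ (s 1 ⊗ s 5) ⊕ ⊝ (κ (+ 57600) ⊗ (s 3 ⊗ s 3)))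
      ≈⟨ ℛ.+-congʳ (⊗-congˡ (κ (- + 12)) s₁-⊗-s₅) ⟩
    κ (- + 12) ⊗ (κ (+ 42) ⊗ s 5 ⊕ κ (+ 40) ⊗ s 3 ⊕ κ (+ 2) ⊗ s 1) ⊕ (κ (+ 12096) ⊗ (s 1 ⊗ s 5) ⊕ ⊝ (κ (+ 57600) ⊗ (s 3 ⊗ s 3)))
      ≈⟨ solve 3 (λ x y z → con (- + 12) :* (con (+ 42) :* z :+ con (+ 40) :* y :+ con (+ 2) :* x) :+ (con (+ 12096) :* (x :* z) :- con (+ 57600) :* (y :* y)) :=
           (con 1ℤ :+ con (- + 24) :* x) :* (con 1ℤ :+ con (- + 504) :* z) :- (con 1ℤ :+ con (+ 240) :* y) :* (con 1ℤ :+ con (+ 240) :* y)) ℛ.refl (s 1) (s 3) (s 5) ⟩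
    P ⊗ R ⊕ ⊝ (Q ⊗ Q)                         ∎

  -- The Eisenstein series of weight 10. The factor -24 matches 420 · 12 to 240 · (-504); the terms
  -- 504 `s 5` and -240 `s 3` that come with it cancel the linear terms of the product.
  Q⊗R : Q ⊗ R ≈ κ 1ℤ ⊕ κ (- + 264) ⊗ s 9
  Q⊗R = begin
    Q ⊗ R
      ≈⟨ solve 3 (λ y z w′ → (con 1ℤ :+ con (+ 240) :* y) :* (con 1ℤ :+ con (- + 504) :* z) :=
           con 1ℤ :+ con (+ 240) :* y :+ con (- + 504) :* z :+ con (- + 24) :* (con (+ 420) :* (con (+ 6) :* (y :* z) :+ con (+ 6) :* (z :* y) :+ con 0ℤ :* (y :* y) :+ con 0ℤ :* w′))) ℛ.refl (s 3) (s 5) (D (s 7)) ⟩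
    κ 1ℤ ⊕ κ (+ 240) ⊗ s 3 ⊕ κ (- + 504) ⊗ s 5 ⊕ κ (- + 24) ⊗ (κ (+ 420) ⊗ (κ (+ 6) ⊗ (s 3 ⊗ s 5) ⊕ κ (+ 6) ⊗ (s 5 ⊗ s 3) ⊕ κ (+ 0) ⊗ (s 3 ⊗ s 3) ⊕ κ (+ 0) ⊗ D (s 7)))
      ≈⟨ ℛ.+-congˡ {κ 1ℤ ⊕ κ (+ 240) ⊗ s 3 ⊕ κ (- + 504) ⊗ s 5} (⊗-congˡ (κ (- + 24)) s₃-⊗-s₅) ⟩
    κ 1ℤ ⊕ κ (+ 240) ⊗ s 3 ⊕ κ (- + 504) ⊗ s 5 ⊕ κ (- + 24) ⊗ (κ (+ 11) ⊗ s 9 ⊕ κ (- + 21) ⊗ s 5 ⊕ κ (+ 10) ⊗ s 3)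
      ≈⟨ solve 3 (λ y z w → con 1ℤ :+ con (+ 240) :* y :+ con (- + 504) :* z :+ con (- + 24) :* (con (+ 11) :* w :+ con (- + 21) :* z :+ con (+ 10) :* y) :=
           con 1ℤ :+ con (- + 264) :* w) ℛ.refl (s 3) (s 5) (s 9) ⟩
    κ 1ℤ ⊕ κ (- + 264) ⊗ s 9 ∎

  Z : Series
  Z = Q ⊗ Q ⊗ Q ⊕ ⊝ (R ⊗ R)

  D-Q⊗R : D (Q ⊗ R) ≈ κ (- + 264) ⊗ D (s 9)
  D-Q⊗R n = trans (D-cong Q⊗R n) (D-affine 1ℤ (- + 264) (s 9) n)

  DZ : D Z ≈ P ⊗ Z
  DZ = begin
    D Z
      ≈⟨ (λ n → trans (D-⊕ (Q ⊗ Q ⊗ Q) (⊝ (R ⊗ R)) n) (cong₂ _+_ (D-cube n) (trans (D-⊝ (R ⊗ R) n) (cong -_ (D-⊗ R R n))))) ⟩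
    ((D Q ⊗ Q ⊕ Q ⊗ D Q) ⊗ Q ⊕ Q ⊗ Q ⊗ D Q) ⊕ ⊝ (D R ⊗ R ⊕ R ⊗ D R)
      ≈⟨ solve 4 (λ Q R Q′ R′ → (Q′ :* Q :+ Q :* Q′) :* Q :+ Q :* Q :* Q′ :- (R′ :* R :+ R :* R′) :=
            Q :* Q :* (con (+ 3) :* Q′) :- R :* (con (+ 2) :* R′)) ℛ.refl Q R (D Q) (D R) ⟩
    Q ⊗ Q ⊗ (κ (+ 3) ⊗ D Q) ⊕ ⊝ (R ⊗ (κ (+ 2) ⊗ D R))
      ≈⟨ ℛ.+-cong (⊗-congˡ (Q ⊗ Q) 3DQ) (ℛ.-‿cong (⊗-congˡ R 2DR)) ⟩
    Q ⊗ Q ⊗ (P ⊗ Q ⊕ ⊝ R) ⊕ ⊝ (R ⊗ (P ⊗ R ⊕ ⊝ (Q ⊗ Q)))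
      ≈⟨ solve 3 (λ P Q R → Q :* Q :* (P :* Q :- R) :- R :* (P :* R :- Q :* Q) := P :* (Q :* Q :* Q :- R :* R)) ℛ.refl P Q R ⟩
    P ⊗ Z ∎
    where
    D-cube : D (Q ⊗ Q ⊗ Q) ≈ (D Q ⊗ Q ⊕ Q ⊗ D Q) ⊗ Q ⊕ Q ⊗ Q ⊗ D Q
    D-cube n = trans (D-⊗ (Q ⊗ Q) Q n) (cong (_+ (Q ⊗ Q ⊗ D Q) n) (⊗-congʳ Q (D-⊗ Q Q) n))

  -- The left side is a multiple of the first Rankin–Cohen bracket of Q and R.
  first-order : κ (+ 10) ⊗ (Q ⊗ D R) ⊕ κ (- + 6) ⊗ D (Q ⊗ R) ≈ κ (- + 2) ⊗ Z
  first-order = begin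
    κ (+ 10) ⊗ (Q ⊗ D R) ⊕ κ (- + 6) ⊗ D (Q ⊗ R)
      ≈⟨ ℛ.+-congˡ {κ (+ 10) ⊗ (Q ⊗ D R)} (⊗-congˡ (κ (- + 6)) (D-⊗ Q R)) ⟩
    κ (+ 10) ⊗ (Q ⊗ D R) ⊕ κ (- + 6) ⊗ (D Q ⊗ R ⊕ Q ⊗ D R)
      ≈⟨ solve 4 (λ Q R Q′ R′ → con (+ 10) :* (Q :* R′) :+ con (- + 6) :* (Q′ :* R :+ Q :* R′) :=
           con (+ 2) :* (Q :* (con (+ 2) :* R′)) :- con (+ 2) :* ((con (+ 3) :* Q′) :* R)) ℛ.refl Q R (D Q) (D R) ⟩
    κ (+ 2) ⊗ (Q ⊗ (κ (+ 2) ⊗ D R)) ⊕ ⊝ (κ (+ 2) ⊗ ((κ (+ 3) ⊗ D Q) ⊗ R))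
      ≈⟨ ℛ.+-cong (⊗-congˡ (κ (+ 2)) (⊗-congˡ Q 2DR)) (ℛ.-‿cong (⊗-congˡ (κ (+ 2)) (⊗-congʳ R 3DQ))) ⟩
    κ (+ 2) ⊗ (Q ⊗ (P ⊗ R ⊕ ⊝ (Q ⊗ Q))) ⊕ ⊝ (κ (+ 2) ⊗ ((P ⊗ Q ⊕ ⊝ R) ⊗ R))
      ≈⟨ solve 3 (λ P Q R → con (+ 2) :* (Q :* (P :* R :- Q :* Q)) :- con (+ 2) :* ((P :* Q :- R) :* R) :=
               con (- + 2) :* (Q :* Q :* Q :- R :* R)) ℛ.refl P Q R ⟩
    κ (- + 2) ⊗ Z ∎

  DDQ : κ (+ 3) ⊗ D (D Q) ≈ D P ⊗ Q ⊕ P ⊗ D Q ⊕ ⊝ D R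
  DDQ n = trans (sym (D-κ⊗ (+ 3) (D Q) n)) (trans (D-cong 3DQ n)
    (trans (D-⊕ (P ⊗ Q) (⊝ R) n) (cong₂ _+_ (D-⊗ P Q n) (D-⊝ R n))))

  DDR : κ (+ 2) ⊗ D (D R) ≈ D P ⊗ R ⊕ P ⊗ D R ⊕ ⊝ (D Q ⊗ Q ⊕ Q ⊗ D Q)
  DDR n = trans (sym (D-κ⊗ (+ 2) (D R) n)) (trans (D-cong 2DR n)
    (trans (D-⊕ (P ⊗ R) (⊝ (Q ⊗ Q)) n) (cong₂ _+_ (D-⊗ P R n) (trans (D-⊝ (Q ⊗ Q) n) (cong -_ (D-⊗ Q Q n))))))

  DD-Q⊗R : D (D (Q ⊗ R)) ≈ (D (D Q) ⊗ R ⊕ D Q ⊗ D R) ⊕ (D Q ⊗ D R ⊕ Q ⊗ D (D R))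
  DD-Q⊗R n = trans (D-cong (D-⊗ Q R) n) (trans (D-⊕ (D Q ⊗ R) (Q ⊗ D R) n) (cong₂ _+_ (D-⊗ (D Q) R n) (D-⊗ Q (D R) n)))

  -- Expanded in P, Q, R, the monomials P² Q R and Q² R both have coefficient 55/72 in the second
  -- derivative of Q R and both have 1/6 in D Q · D R. The ratio -72 : 330 thus removes the two at
  -- once and leaves a multiple of P (Q³ - R²).
  second-order : κ (- + 72) ⊗ D (D (Q ⊗ R)) ⊕ κ (+ 330) ⊗ (D Q ⊗ D R) ≈ κ (+ 11) ⊗ (P ⊗ Z)
  second-order = begin
    κ (- + 72) ⊗ D (D (Q ⊗ R)) ⊕ κ (+ 330) ⊗ (D Q ⊗ D R)
      ≈⟨ ℛ.+-congʳ (⊗-congˡ (κ (- + 72)) DD-Q⊗R) ⟩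
    κ (- + 72) ⊗ ((D (D Q) ⊗ R ⊕ D Q ⊗ D R) ⊕ (D Q ⊗ D R ⊕ Q ⊗ D (D R))) ⊕ κ (+ 330) ⊗ (D Q ⊗ D R)
      ≈⟨ solve 6 (λ Q R Q′ R′ Q″ R″ → con (- + 72) :* ((Q″ :* R :+ Q′ :* R′) :+ (Q′ :* R′ :+ Q :* R″)) :+ con (+ 330) :* (Q′ :* R′) :=
            con (- + 24) :* ((con (+ 3) :* Q″) :* R) :+ con (- + 36) :* (Q :* (con (+ 2) :* R″)) :+ con (+ 186) :* (Q′ :* R′)) ℛ.refl Q R (D Q) (D R) (D (D Q)) (D (D R)) ⟩
    κ (- + 24) ⊗ ((κ (+ 3) ⊗ D (D Q)) ⊗ R) ⊕ κ (- + 36) ⊗ (Q ⊗ (κ (+ 2) ⊗ D (D R))) ⊕ κ (+ 186) ⊗ (D Q ⊗ D R)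
      ≈⟨ ℛ.+-congʳ (ℛ.+-cong (⊗-congˡ (κ (- + 24)) (⊗-congʳ R DDQ)) (⊗-congˡ (κ (- + 36)) (⊗-congˡ Q DDR))) ⟩
    κ (- + 24) ⊗ ((D P ⊗ Q ⊕ P ⊗ D Q ⊕ ⊝ D R) ⊗ R) ⊕ κ (- + 36) ⊗ (Q ⊗ (D P ⊗ R ⊕ P ⊗ D R ⊕ ⊝ (D Q ⊗ Q ⊕ Q ⊗ D Q))) ⊕ κ (+ 186) ⊗ (D Q ⊗ D R)
      -- The derivatives are collected into 12 D P, 3 D Q and 2 D R, the multiples for which the
      -- differential equations have integer coefficients.
      ≈⟨ solve 6 (λ P Q R P′ Q′ R′ →
            con (- + 24) :* ((P′ :* Q :+ P :* Q′ :- R′) :* R) :+ con (- + 36) :* (Q :* (P′ :* R :+ P :* R′ :- (Q′ :* Q :+ Q :* Q′))) :+ con (+ 186) :* (Q′ :* R′) :=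
            con (- + 5) :* (Q :* R) :* (con (+ 12) :* P′) :+ (con (- + 8) :* (P :* R) :+ con (+ 24) :* (Q :* Q)) :* (con (+ 3) :* Q′)
              :+ (con (+ 12) :* R :+ con (- + 18) :* (P :* Q)) :* (con (+ 2) :* R′) :+ con (+ 31) :* ((con (+ 3) :* Q′) :* (con (+ 2) :* R′))) ℛ.refl P Q R (D P) (D Q) (D R) ⟩
    κ (- + 5) ⊗ (Q ⊗ R) ⊗ (κ (+ 12) ⊗ D P) ⊕ (κ (- + 8) ⊗ (P ⊗ R) ⊕ κ (+ 24) ⊗ (Q ⊗ Q)) ⊗ (κ (+ 3) ⊗ D Q)
      ⊕ (κ (+ 12) ⊗ R ⊕ κ (- + 18) ⊗ (P ⊗ Q)) ⊗ (κ (+ 2) ⊗ D R) ⊕ κ (+ 31) ⊗ ((κ (+ 3) ⊗ D Q) ⊗ (κ (+ 2) ⊗ D R))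
      ≈⟨ ℛ.+-cong (ℛ.+-cong (ℛ.+-cong (⊗-congˡ (κ (- + 5) ⊗ (Q ⊗ R)) 12DP) (⊗-congˡ (κ (- + 8) ⊗ (P ⊗ R) ⊕ κ (+ 24) ⊗ (Q ⊗ Q)) 3DQ))
           (⊗-congˡ (κ (+ 12) ⊗ R ⊕ κ (- + 18) ⊗ (P ⊗ Q)) 2DR)) (⊗-congˡ (κ (+ 31)) (⊗-cong 3DQ 2DR)) ⟩
    κ (- + 5) ⊗ (Q ⊗ R) ⊗ (P ⊗ P ⊕ ⊝ Q) ⊕ (κ (- + 8) ⊗ (P ⊗ R) ⊕ κ (+ 24) ⊗ (Q ⊗ Q)) ⊗ (P ⊗ Q ⊕ ⊝ R)
      ⊕ (κ (+ 12) ⊗ R ⊕ κ (- + 18) ⊗ (P ⊗ Q)) ⊗ (P ⊗ R ⊕ ⊝ (Q ⊗ Q)) ⊕ κ (+ 31) ⊗ ((P ⊗ Q ⊕ ⊝ R) ⊗ (P ⊗ R ⊕ ⊝ (Q ⊗ Q)))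
      ≈⟨ solve 3 (λ P Q R →
            con (- + 5) :* (Q :* R) :* (P :* P :- Q) :+ (con (- + 8) :* (P :* R) :+ con (+ 24) :* (Q :* Q)) :* (P :* Q :- R)
              :+ (con (+ 12) :* R :+ con (- + 18) :* (P :* Q)) :* (P :* R :- Q :* Q) :+ con (+ 31) :* ((P :* Q :- R) :* (P :* R :- Q :* Q)) :=
            con (+ 11) :* (P :* (Q :* Q :* Q :- R :* R))) ℛ.refl P Q R ⟩
    κ (+ 11) ⊗ (P ⊗ Z) ∎

open Ramanujan

-- The product for τ and the discriminant Q³ - R².

module Discriminant where
  open import Data.Integer.Base using (_+_; _*_; -_; _-_)
  open import Data.Integer.Properties
  open import Algebra.Properties.AbelianGroup +-0-abelianGroup using () renaming (∙-cancelˡ to +-cancelˡ)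
  open SeriesSolver
  open import Relation.Binary.Reasoning.Setoid ℛ.setoid

  -- `D f ≈ g ⊗ f` expresses without division that g is the logarithmic derivative of f; under
  -- products these add.
  D-⊛-log : ∀ f f′ g g′ → D f ≈ g ⊗ f → D f′ ≈ g′ ⊗ f′ → D (f ⊛ f′) ≈ (g ⊕ g′) ⊗ (f ⊛ f′)
  D-⊛-log f f′ g g′ Df Df′ = begin
    D (f ⊛ f′)                       ≈⟨ D-cong (⊗≈⊛ f f′) ⟨
    D (f ⊗ f′)                       ≈⟨ D-⊗ f f′ ⟩
    D f ⊗ f′ ⊕ f ⊗ D f′              ≈⟨ ℛ.+-cong (⊗-congʳ f′ Df) (⊗-congˡ f Df′) ⟩
    g ⊗ f ⊗ f′ ⊕ f ⊗ (g′ ⊗ f′)       ≈⟨ solve 4 (λ f f′ g g′ → g :* f :* f′ :+ f :* (g′ :* f′) :=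
             (g :+ g′) :* (f :* f′)) ℛ.refl f f′ g g′ ⟩
    (g ⊕ g′) ⊗ (f ⊗ f′)              ≈⟨ ⊗-congˡ (g ⊕ g′) (⊗≈⊛ f f′) ⟩
    (g ⊕ g′) ⊗ (f ⊛ f′)              ∎

  κ-⊝ : ∀ z → κ (- z) ≈ ⊝ κ z
  κ-⊝ z zero    = refl
  κ-⊝ z (suc n) = refl

  D-1ₛ : D 1ₛ ≈ κ 0ℤ ⊗ 1ₛ
  D-1ₛ = begin
    D 1ₛ          ≈⟨ D-cong 1ₛ≈κ1 ⟩
    D (κ 1ℤ)      ≈⟨ D-κ 1ℤ ⟩
    κ 0ℤ          ≈⟨ ℛ.zeroˡ 1ₛ ⟨
    κ 0ℤ ⊗ 1ₛ     ∎

  D-^ₛ-log : ∀ f g → D f ≈ g ⊗ f → ∀ m → D (f ^ₛ m) ≈ (κ (+ m) ⊗ g) ⊗ f ^ₛ m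
  D-^ₛ-log f g Df zero    = begin
    D 1ₛ                     ≈⟨ D-1ₛ ⟩
    κ 0ℤ ⊗ 1ₛ                ≈⟨ ⊗-congʳ 1ₛ (ℛ.zeroˡ g) ⟨
    (κ 0ℤ ⊗ g) ⊗ 1ₛ          ∎
  D-^ₛ-log f g Df (suc m) = begin
    D (f ⊛ f ^ₛ m)                              ≈⟨ D-⊛-log f (f ^ₛ m) g (κ (+ m) ⊗ g) Df (D-^ₛ-log f g Df m) ⟩
    (g ⊕ κ (+ m) ⊗ g) ⊗ (f ⊛ f ^ₛ m)            ≈⟨ ⊗-congʳ (f ⊛ f ^ₛ m) (solve 2 (λ k g → g :+ k :* g :=
             (con 1ℤ :+ k) :* g) ℛ.refl (κ (+ m)) g) ⟩
    ((κ 1ℤ ⊕ κ (+ m)) ⊗ g) ⊗ (f ⊛ f ^ₛ m)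
      ≈⟨ ⊗-congʳ (f ⊛ f ^ₛ m) (⊗-congʳ g (λ { zero → refl ; (suc n) → refl })) ⟩
    (κ (+ suc m) ⊗ g) ⊗ (f ⊛ f ^ₛ m)            ∎

  -- With A = q^(a+1) and x = `L (suc a)`, the equation x = A (1 + x) says A = x (1 - A), so the
  -- derivative -(a+1) A of 1 - A is a multiple of 1 - A.
  D-1⊖q^ : ∀ a → D (1ₛ ⊖ q^ suc a) ≈ (κ (- + suc a) ⊗ L (suc a)) ⊗ (1ₛ ⊖ q^ suc a)
  D-1⊖q^ a = begin
    D (1ₛ ⊕ ⊝ A)
      ≈⟨ (λ n → trans (D-⊕ 1ₛ (⊝ A) n) (cong₂ _+_ (trans (D-cong 1ₛ≈κ1 n) (D-κ 1ℤ n)) (trans (D-⊝ A n) (cong -_ (D-q^ (suc a) n))))) ⟩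
    κ 0ℤ ⊕ ⊝ (κ (+ suc a) ⊗ A)           ≈⟨ solve 3 (λ k A x → con 0ℤ :- k :* A :=
             :- k :* (A :* (con 1ℤ :+ x)) :- :- k :* (x :* A)) ℛ.refl (κ (+ suc a)) A x ⟩
    ⊝ κ (+ suc a) ⊗ (A ⊗ (κ 1ℤ ⊕ x)) ⊕ ⊝ (⊝ κ (+ suc a) ⊗ (x ⊗ A))
      ≈⟨ ℛ.+-congʳ {⊝ (⊝ κ (+ suc a) ⊗ (x ⊗ A))} (⊗-congˡ (⊝ κ (+ suc a)) (L-geometric a)) ⟨
    ⊝ κ (+ suc a) ⊗ x ⊕ ⊝ (⊝ κ (+ suc a) ⊗ (x ⊗ A))
      ≈⟨ solve 3 (λ k A x → :- k :* x :- :- k :* (x :* A) := :- k :* x :* (con 1ℤ :- A)) ℛ.refl (κ (+ suc a)) A x ⟩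
    (⊝ κ (+ suc a) ⊗ x) ⊗ (κ 1ℤ ⊕ ⊝ A)   ≈⟨ ⊗-cong (⊗-congʳ x (ℛ.sym (κ-⊝ (+ suc a)))) (ℛ.+-congʳ (ℛ.sym 1ₛ≈κ1)) ⟩
    (κ (- + suc a) ⊗ x) ⊗ (1ₛ ⊖ A)       ∎
    where
    A = q^ suc a
    x = L (suc a)

  -- The exponent 1 is kept so that `Λ σ₁` is `s 1` by definition.
  σ₁ : ℕ → ℤ
  σ₁ c = + (c ℕ.^ 1)

  D-∏-log : ∀ m N → D (∏ (factor m) N) ≈ (κ (- + m) ⊗ Λ[ N ] σ₁) ⊗ ∏ (factor m) N
  D-∏-log m zero    = begin
    D 1ₛ                                     ≈⟨ D-1ₛ ⟩
    κ 0ℤ ⊗ 1ₛ                                ≈⟨ ⊗-congʳ 1ₛ (ℛ.sym (ℛ.zeroʳ (κ (- + m)))) ⟩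
    (κ (- + m) ⊗ κ 0ℤ) ⊗ 1ₛ                 ≈⟨ ⊗-congʳ 1ₛ (⊗-congˡ (κ (- + m)) κ0) ⟩
    (κ (- + m) ⊗ Λ[ 0 ] σ₁) ⊗ 1ₛ            ∎
  D-∏-log m (suc N) = begin
    D (f ⊛ ∏ (factor m) N)
      ≈⟨ D-⊛-log f (∏ (factor m) N) (κ (+ m) ⊗ (κ (- + suc N) ⊗ x)) (κ (- + m) ⊗ Λ[ N ] σ₁) (D-^ₛ-log (1ₛ ⊖ q^ suc N) (κ (- + suc N) ⊗ x) (D-1⊖q^ N) m) (D-∏-log m N) ⟩
    (κ (+ m) ⊗ (κ (- + suc N) ⊗ x) ⊕ κ (- + m) ⊗ Λ[ N ] σ₁) ⊗ ∏ (factor m) (suc N)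
      ≈⟨ ⊗-congʳ (∏ (factor m) (suc N)) (ℛ.+-congʳ {κ (- + m) ⊗ Λ[ N ] σ₁} (⊗-congˡ (κ (+ m)) (⊗-congʳ x (κ-⊝ (+ suc N))))) ⟩
    (κ (+ m) ⊗ (⊝ κ (+ suc N) ⊗ x) ⊕ κ (- + m) ⊗ Λ[ N ] σ₁) ⊗ ∏ (factor m) (suc N)
      ≈⟨ ⊗-congʳ (∏ (factor m) (suc N)) (ℛ.+-congˡ {κ (+ m) ⊗ (⊝ κ (+ suc N) ⊗ x)} (⊗-congʳ (Λ[ N ] σ₁) (κ-⊝ (+ m)))) ⟩
    (κ (+ m) ⊗ (⊝ κ (+ suc N) ⊗ x) ⊕ ⊝ κ (+ m) ⊗ Λ[ N ] σ₁) ⊗ ∏ (factor m) (suc N)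
      ≈⟨ ⊗-congʳ (∏ (factor m) (suc N)) (solve 4 (λ m k x y → m :* (:- k :* x) :+ :- m :* y :=
               :- m :* (y :+ k :* x)) ℛ.refl (κ (+ m)) (κ (+ suc N)) x (Λ[ N ] σ₁)) ⟩
    (⊝ κ (+ m) ⊗ (Λ[ N ] σ₁ ⊕ κ (+ suc N) ⊗ x)) ⊗ ∏ (factor m) (suc N)
      ≈⟨ ⊗-congʳ (∏ (factor m) (suc N)) (⊗-cong (ℛ.sym (κ-⊝ (+ m))) (λ n → cong (_+_ (Λ[ N ] σ₁ n)) (trans (κ-⊗ (+ suc N) x n) (cong (λ c → + c * x n) (sym (ℕ.*-identityʳ (suc N))))))) ⟩
    (κ (- + m) ⊗ Λ[ suc N ] σ₁) ⊗ ∏ (factor m) (suc N) ∎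
    where
    f = factor m (suc N)
    x = L (suc N)

  -- Coefficient n of the infinite product is by definition that of the n-th partial product. In
  -- degrees up to n both the partial product and the truncated Lambert series agree with their
  -- limits, and coefficient n of a product depends on no others.
  D-∏∞-log : ∀ m → D (∏∞ (factor m)) ≈ (κ (- + m) ⊗ s 1) ⊗ ∏∞ (factor m)
  D-∏∞-log m n = trans (D-∏-log m n n) (⊗-cong≤ n
    (λ k k≤n → trans (κ-⊗ (- + m) (Λ[ n ] σ₁) k) (trans (cong (_*_ (- + m)) (Λ-partial σ₁ k≤n)) (sym (κ-⊗ (- + m) (s 1) k))))
    (λ k k≤n → proj₂ (∏factor-converges m k) n k≤n))

  -- The factor q contributes 1 and the product contributes -24 `s 1`; their sum is the definition
  -- of `P`.
  Dτ : D τ ≈ P ⊗ τ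
  Dτ = D-⊛-log (q^ 1) (∏∞ (factor 24)) (κ 1ℤ) (κ (- + 24) ⊗ s 1) (D-q^ 1) (D-∏∞-log 24)

  opaque
    unfolding _⊗_

    P-0 : P 0 ≡ 1ℤ
    P-0 = refl

    Z-0 : Z 0 ≡ 0ℤ
    Z-0 = refl

    -- 3 · 240 from Q³ and 2 · 504 from -R².
    Z-1 : Z 1 ≡ + 1728
    Z-1 = refl

    ⊗-shiftˡ : ∀ f g n → (f ⊗ g) (suc n) ≡ f 0 * g (suc n) + (shift f ⊗ g) n
    ⊗-shiftˡ f g n = refl

  -- In degree n the equation reads (n - 1) X n = ∑_{0 < i} P i X (n - i).
  D≈P⊗-unique : ∀ X → D X ≈ P ⊗ X → X 0 ≡ 0ℤ → X 1 ≡ 0ℤ → X ≈ κ 0ℤ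
  D≈P⊗-unique X DX X0 X1 n = below (suc n) n ℕ.≤-refl
    where
    below : ∀ N n → n < N → X n ≡ κ 0ℤ n
    below N       zero          _           = X0
    below N       (suc zero)    _           = X1
    below (suc N) (suc (suc k)) (s≤s n<1+N) with i*j≡0⇒i≡0∨j≡0 (+ suc k) {X (suc (suc k))} 
      (+-cancelˡ x (+ suc k * x) 0ℤ (trans (sym (suc-* (+ suc k) x)) recurrence))
      where
      x = X (suc (suc k))
      recurrence : (1ℤ + + suc k) * x ≡ x + 0ℤ
      recurrence = trans (DX (suc (suc k))) (trans (⊗-shiftˡ P X (suc k)) (cong₂ _+_
        (trans (cong (_* x) P-0) (*-identityˡ x))
        (trans (⊗-cong≤ {shift P} {shift P} {X} {κ 0ℤ} (suc k) (λ _ _ → refl) (λ m m≤1+k → below N m (ℕ.≤-<-trans m≤1+k n<1+N)))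
          (ℛ.zeroʳ (shift P) (suc k)))))
    ... | inj₂ x≡0 = x≡0

  1728τ≈Z : κ (+ 1728) ⊗ τ ≈ Z
  -- The initial values `τ 0` = 0 and `τ 1` = 1 are evaluated from the definition of `τ`.
  1728τ≈Z n = i-j≡0⇒i≡j _ _ (trans (D≈P⊗-unique X DX (cong₂ _-_ (κ-⊗ (+ 1728) τ 0) Z-0) (cong₂ _-_ (κ-⊗ (+ 1728) τ 1) Z-1) n) (κ0 n))
    where
    X = κ (+ 1728) ⊗ τ ⊕ ⊝ Z
    DX : D X ≈ P ⊗ X
    DX = begin
      D X
        ≈⟨ (λ n → trans (D-⊕ (κ (+ 1728) ⊗ τ) (⊝ Z) n) (cong₂ _+_ (D-κ⊗ (+ 1728) τ n) (D-⊝ Z n))) ⟩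
      κ (+ 1728) ⊗ D τ ⊕ ⊝ D Z                   ≈⟨ ℛ.+-cong (⊗-congˡ (κ (+ 1728)) Dτ) (ℛ.-‿cong DZ) ⟩
      κ (+ 1728) ⊗ (P ⊗ τ) ⊕ ⊝ (P ⊗ Z)           ≈⟨ solve 3 (λ P t Z → con (+ 1728) :* (P :* t) :- P :* Z :=
               P :* (con (+ 1728) :* t :- Z)) ℛ.refl P τ Z ⟩
      P ⊗ X                                      ∎

open Discriminant

-- The five identities as equations between series.

module TauSeries where
  open import Data.Integer.Base using (_+_; _*_; -_; _-_)
  open import Data.Integer.Properties
  open SeriesSolver
  open import Relation.Binary.Reasoning.Setoid ℛ.setoid

  κ-cancel : ∀ z {f g} .{{_ : NonZero z}} → κ z ⊗ f ≈ κ z ⊗ g → f ≈ g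
  κ-cancel z {f} {g} zf≈zg n = *-cancelˡ-≡ z (f n) (g n) (trans (sym (κ-⊗ z f n)) (trans (zf≈zg n) (κ-⊗ z g n)))

  -- `first-order` is written with Q · D R and D (Q R) because the latter is linear in `s 9`, which
  -- leaves a single product. The factor -144 comes from -144 · 24 = -2 · 1728.
  τ-i : κ (+ 24) ⊗ τ ≈ κ (- + 11) ⊗ D (s 9) ⊕ κ (+ 35) ⊗ D (s 5) ⊕ κ (+ 8400) ⊗ (s 3 ⊗ D (s 5))
  τ-i = κ-cancel (- + 144) (begin
    κ (- + 144) ⊗ (κ (+ 24) ⊗ τ)
      ≈⟨ solve 1 (λ t → con (- + 144) :* (con (+ 24) :* t) := con (- + 2) :* (con (+ 1728) :* t)) ℛ.refl τ ⟩
    κ (- + 2) ⊗ (κ (+ 1728) ⊗ τ)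
      ≈⟨ ⊗-congˡ (κ (- + 2)) 1728τ≈Z ⟩
    κ (- + 2) ⊗ Z
      ≈⟨ first-order ⟨
    κ (+ 10) ⊗ (Q ⊗ D R) ⊕ κ (- + 6) ⊗ D (Q ⊗ R)
      ≈⟨ ℛ.+-cong (⊗-congˡ (κ (+ 10)) (⊗-congˡ Q (D-affine 1ℤ (- + 504) (s 5)))) (⊗-congˡ (κ (- + 6)) D-Q⊗R) ⟩
    κ (+ 10) ⊗ (Q ⊗ (κ (- + 504) ⊗ D (s 5))) ⊕ κ (- + 6) ⊗ (κ (- + 264) ⊗ D (s 9))
      ≈⟨ solve 3 (λ y z′ w′ → con (+ 10) :* ((con 1ℤ :+ con (+ 240) :* y) :* (con (- + 504) :* z′)) :+ con (- + 6) :* (con (- + 264) :* w′) :=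
           con (- + 144) :* (con (- + 11) :* w′ :+ con (+ 35) :* z′ :+ con (+ 8400) :* (y :* z′))) ℛ.refl (s 3) (D (s 5)) (D (s 9)) ⟩
    κ (- + 144) ⊗ (κ (- + 11) ⊗ D (s 9) ⊕ κ (+ 35) ⊗ D (s 5) ⊕ κ (+ 8400) ⊗ (s 3 ⊗ D (s 5))) ∎)

  D-s₃⊗s₅ : κ (+ 5040) ⊗ (D (s 3) ⊗ s 5 ⊕ s 3 ⊗ D (s 5)) ≈ κ (+ 11) ⊗ D (s 9) ⊕ κ (- + 21) ⊗ D (s 5) ⊕ κ (+ 10) ⊗ D (s 3)
  D-s₃⊗s₅ = begin
    κ (+ 5040) ⊗ (D (s 3) ⊗ s 5 ⊕ s 3 ⊗ D (s 5))
      ≈⟨ ⊗-congˡ (κ (+ 5040)) (D-⊗ (s 3) (s 5)) ⟨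
    κ (+ 5040) ⊗ D (s 3 ⊗ s 5)
      ≈⟨ D-κ⊗ (+ 5040) (s 3 ⊗ s 5) ⟨
    D (κ (+ 5040) ⊗ (s 3 ⊗ s 5))
      ≈⟨ D-cong (solve 3 (λ y z w′ → con (+ 5040) :* (y :* z) :=
               con (+ 420) :* (con (+ 6) :* (y :* z) :+ con (+ 6) :* (z :* y) :+ con 0ℤ :* (y :* y) :+ con 0ℤ :* w′))
             ℛ.refl (s 3) (s 5) (D (s 7))) ⟩
    D (κ (+ 420) ⊗ (κ (+ 6) ⊗ (s 3 ⊗ s 5) ⊕ κ (+ 6) ⊗ (s 5 ⊗ s 3) ⊕ κ (+ 0) ⊗ (s 3 ⊗ s 3) ⊕ κ (+ 0) ⊗ D (s 7)))
      ≈⟨ D-cong s₃-⊗-s₅ ⟩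
    D (κ (+ 11) ⊗ s 9 ⊕ κ (- + 21) ⊗ s 5 ⊕ κ (+ 10) ⊗ s 3)
      ≈⟨ D-linear (+ 11) (- + 21) (+ 10) (s 9) (s 5) (s 3) ⟩
    κ (+ 11) ⊗ D (s 9) ⊕ κ (- + 21) ⊗ D (s 5) ⊕ κ (+ 10) ⊗ D (s 3) ∎
    where
    D-linear : ∀ a b c f g h → D (κ a ⊗ f ⊕ κ b ⊗ g ⊕ κ c ⊗ h) ≈ κ a ⊗ D f ⊕ κ b ⊗ D g ⊕ κ c ⊗ D h
    D-linear a b c f g h n = trans (D-⊕ (κ a ⊗ f ⊕ κ b ⊗ g) (κ c ⊗ h) n) (cong₂ _+_
      (trans (D-⊕ (κ a ⊗ f) (κ b ⊗ g) n) (cong₂ _+_ (D-κ⊗ a f n) (D-κ⊗ b g n))) (D-κ⊗ c h n))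

  τ-ii : κ (+ 36) ⊗ τ ≈ κ (+ 11) ⊗ D (s 9) ⊕ κ (+ 25) ⊗ D (s 3) ⊕ κ (- + 12600) ⊗ (D (s 3) ⊗ s 5)
  τ-ii = κ-cancel (+ 2) (begin
    κ (+ 2) ⊗ (κ (+ 36) ⊗ τ)
      -- Zero is added as 5 · 5040 x - 25200 x, where x is the derivative of the product of `s 3`
      -- and `s 5`. Rewriting only the first part by `D-s₃⊗s₅` cancels D (s 5), as 3 · 35 = 5 · 21,
      -- and `s 3 ⊗ D (s 5)`, as 3 · 8400 = 25200.
      ≈⟨ solve 2 (λ t x → con (+ 2) :* (con (+ 36) :* t) :=
               con (+ 3) :* (con (+ 24) :* t) :+ con (+ 5) :* (con (+ 5040) :* x) :- con (+ 25200) :* x)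
             ℛ.refl τ (D (s 3) ⊗ s 5 ⊕ s 3 ⊗ D (s 5)) ⟩
    κ (+ 3) ⊗ (κ (+ 24) ⊗ τ) ⊕ κ (+ 5) ⊗ (κ (+ 5040) ⊗ (D (s 3) ⊗ s 5 ⊕ s 3 ⊗ D (s 5))) ⊕ ⊝ (κ (+ 25200) ⊗ (D (s 3) ⊗ s 5 ⊕ s 3 ⊗ D (s 5)))
      ≈⟨ ℛ.+-congʳ (ℛ.+-cong (⊗-congˡ (κ (+ 3)) τ-i) (⊗-congˡ (κ (+ 5)) D-s₃⊗s₅)) ⟩
    κ (+ 3) ⊗ (κ (- + 11) ⊗ D (s 9) ⊕ κ (+ 35) ⊗ D (s 5) ⊕ κ (+ 8400) ⊗ (s 3 ⊗ D (s 5)))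
      ⊕ κ (+ 5) ⊗ (κ (+ 11) ⊗ D (s 9) ⊕ κ (- + 21) ⊗ D (s 5) ⊕ κ (+ 10) ⊗ D (s 3)) ⊕ ⊝ (κ (+ 25200) ⊗ (D (s 3) ⊗ s 5 ⊕ s 3 ⊗ D (s 5)))
      ≈⟨ solve 5 (λ a b c x y → con (+ 3) :* (con (- + 11) :* a :+ con (+ 35) :* b :+ con (+ 8400) :* x)
            :+ con (+ 5) :* (con (+ 11) :* a :+ con (- + 21) :* b :+ con (+ 10) :* c) :- con (+ 25200) :* (y :+ x)
            :=
                     con (+ 2) :* (con (+ 11) :* a :+ con (+ 25) :* c :+ con (- + 12600) :* y))
                   ℛ.refl (D (s 9)) (D (s 5)) (D (s 3)) (s 3 ⊗ D (s 5)) (D (s 3) ⊗ s 5) ⟩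
    κ (+ 2) ⊗ (κ (+ 11) ⊗ D (s 9) ⊕ κ (+ 25) ⊗ D (s 3) ⊕ κ (- + 12600) ⊗ (D (s 3) ⊗ s 5)) ∎)

  τ-iv : D τ ≈ D (D (s 9)) ⊕ κ (- + 2100) ⊗ (D (s 3) ⊗ D (s 5))
  -- 19008 = 11 · 1728 = 72 · 264, which fits both the multiple of Z in `second-order` and the
  -- coefficient of `D (D (s 9))`.
  τ-iv = κ-cancel (+ 19008) (begin
    κ (+ 19008) ⊗ D τ
      ≈⟨ ⊗-congˡ (κ (+ 19008)) Dτ ⟩
    κ (+ 19008) ⊗ (P ⊗ τ)
      ≈⟨ solve 2 (λ P t → con (+ 19008) :* (P :* t) := con (+ 11) :* (P :* (con (+ 1728) :* t))) ℛ.refl P τ ⟩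
    κ (+ 11) ⊗ (P ⊗ (κ (+ 1728) ⊗ τ))
      ≈⟨ ⊗-congˡ (κ (+ 11)) (⊗-congˡ P 1728τ≈Z) ⟩
    κ (+ 11) ⊗ (P ⊗ Z)
      ≈⟨ second-order ⟨
    κ (- + 72) ⊗ D (D (Q ⊗ R)) ⊕ κ (+ 330) ⊗ (D Q ⊗ D R)
      ≈⟨ ℛ.+-cong (⊗-congˡ (κ (- + 72)) (λ n → trans (D-cong D-Q⊗R n) (D-κ⊗ (- + 264) (D (s 9)) n)))
           (⊗-congˡ (κ (+ 330)) (⊗-cong (D-affine 1ℤ (+ 240) (s 3)) (D-affine 1ℤ (- + 504) (s 5)))) ⟩
    κ (- + 72) ⊗ (κ (- + 264) ⊗ D (D (s 9))) ⊕ κ (+ 330) ⊗ ((κ (+ 240) ⊗ D (s 3)) ⊗ (κ (- + 504) ⊗ D (s 5)))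
      ≈⟨ solve 3 (λ a y z → con (- + 72) :* (con (- + 264) :* a) :+ con (+ 330) :* ((con (+ 240) :* y) :* (con (- + 504) :* z)) :=
           con (+ 19008) :* (a :+ con (- + 2100) :* (y :* z))) ℛ.refl (D (D (s 9))) (D (s 3)) (D (s 5)) ⟩
    κ (+ 19008) ⊗ (D (D (s 9)) ⊕ κ (- + 2100) ⊗ (D (s 3) ⊗ D (s 5))) ∎)

  D-linear₃ : ∀ a b c f g h k → D (κ a ⊗ f ⊕ κ b ⊗ g ⊕ κ c ⊗ (h ⊗ k)) ≈ κ a ⊗ D f ⊕ κ b ⊗ D g ⊕ κ c ⊗ (D h ⊗ k ⊕ h ⊗ D k)
  D-linear₃ a b c f g h k n = trans (D-⊕ (κ a ⊗ f ⊕ κ b ⊗ g) (κ c ⊗ (h ⊗ k)) n) (cong₂ _+_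
    (trans (D-⊕ (κ a ⊗ f) (κ b ⊗ g) n) (cong₂ _+_ (D-κ⊗ a f n) (D-κ⊗ b g n))) (trans (D-κ⊗ c (h ⊗ k) n) (⊗-congˡ (κ c) (D-⊗ h k) n)))

  τ-iii : κ (+ 6) ⊗ D τ ≈ κ (+ 1) ⊗ D (D (s 9)) ⊕ κ (+ 5) ⊗ D (D (s 3)) ⊕ κ (- + 2520) ⊗ (D (D (s 3)) ⊗ s 5)
  τ-iii = κ-cancel (+ 5) (begin
    κ (+ 5) ⊗ (κ (+ 6) ⊗ D τ)
      -- The derivative of `τ-ii` minus 6 times `τ-iv`: 6 · 2100 = 12600 removes
      -- `D (s 3) ⊗ D (s 5)`.
      ≈⟨ solve 1 (λ t → con (+ 5) :* (con (+ 6) :* t) := con (+ 36) :* t :- con (+ 6) :* t) ℛ.refl (D τ) ⟩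
    κ (+ 36) ⊗ D τ ⊕ ⊝ (κ (+ 6) ⊗ D τ)
      ≈⟨ ℛ.+-cong (λ n → trans (sym (D-κ⊗ (+ 36) τ n)) (trans (D-cong τ-ii n) (D-linear₃ (+ 11) (+ 25) (- + 12600) (D (s 9)) (D (s 3)) (D (s 3)) (s 5) n)))
           (ℛ.-‿cong (⊗-congˡ (κ (+ 6)) τ-iv)) ⟩
    (κ (+ 11) ⊗ D (D (s 9)) ⊕ κ (+ 25) ⊗ D (D (s 3)) ⊕ κ (- + 12600) ⊗ (D (D (s 3)) ⊗ s 5 ⊕ D (s 3) ⊗ D (s 5)))
      ⊕ ⊝ (κ (+ 6) ⊗ (D (D (s 9)) ⊕ κ (- + 2100) ⊗ (D (s 3) ⊗ D (s 5))))
      ≈⟨ solve 4 (λ a c x y → (con (+ 11) :* a :+ con (+ 25) :* c :+ con (- + 12600) :* (x :+ y)) :- con (+ 6) :* (a :+ con (- + 2100) :* y) :=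
           con (+ 5) :* (con (+ 1) :* a :+ con (+ 5) :* c :+ con (- + 2520) :* x)) ℛ.refl (D (D (s 9))) (D (D (s 3))) (D (D (s 3)) ⊗ s 5) (D (s 3) ⊗ D (s 5)) ⟩
    κ (+ 5) ⊗ (κ (+ 1) ⊗ D (D (s 9)) ⊕ κ (+ 5) ⊗ D (D (s 3)) ⊕ κ (- + 2520) ⊗ (D (D (s 3)) ⊗ s 5)) ∎)

  τ-v : κ (+ 4) ⊗ D τ ≈ κ (- + 1) ⊗ D (D (s 9)) ⊕ κ (+ 5) ⊗ D (D (s 5)) ⊕ κ (+ 1200) ⊗ (s 3 ⊗ D (D (s 5)))
  τ-v = κ-cancel (+ 7) (begin
    κ (+ 7) ⊗ (κ (+ 4) ⊗ D τ)
      -- The derivative of `τ-i` plus 4 times `τ-iv`: 4 · 2100 = 8400 removes the same product.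
      ≈⟨ solve 1 (λ t → con (+ 7) :* (con (+ 4) :* t) := con (+ 24) :* t :+ con (+ 4) :* t) ℛ.refl (D τ) ⟩
    κ (+ 24) ⊗ D τ ⊕ κ (+ 4) ⊗ D τ
      ≈⟨ ℛ.+-cong (λ n → trans (sym (D-κ⊗ (+ 24) τ n)) (trans (D-cong τ-i n) (D-linear₃ (- + 11) (+ 35) (+ 8400) (D (s 9)) (D (s 5)) (s 3) (D (s 5)) n)))
           (⊗-congˡ (κ (+ 4)) τ-iv) ⟩
    (κ (- + 11) ⊗ D (D (s 9)) ⊕ κ (+ 35) ⊗ D (D (s 5)) ⊕ κ (+ 8400) ⊗ (D (s 3) ⊗ D (s 5) ⊕ s 3 ⊗ D (D (s 5))))
      ⊕ κ (+ 4) ⊗ (D (D (s 9)) ⊕ κ (- + 2100) ⊗ (D (s 3) ⊗ D (s 5)))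
      ≈⟨ solve 4 (λ a c x y → (con (- + 11) :* a :+ con (+ 35) :* c :+ con (+ 8400) :* (y :+ x)) :+ con (+ 4) :* (a :+ con (- + 2100) :* y) :=
           con (+ 7) :* (con (- + 1) :* a :+ con (+ 5) :* c :+ con (+ 1200) :* x)) ℛ.refl (D (D (s 9))) (D (D (s 5))) (s 3 ⊗ D (D (s 5))) (D (s 3) ⊗ D (s 5)) ⟩
    κ (+ 7) ⊗ (κ (- + 1) ⊗ D (D (s 9)) ⊕ κ (+ 5) ⊗ D (D (s 5)) ⊕ κ (+ 1200) ⊗ (s 3 ⊗ D (D (s 5)))) ∎)

open TauSeries

-- Coefficients of the series as divisor sums and convolution sums.

module Coefficients where
  open ≡-Reasoning

  sum-filter : ∀ {P : Pred ℕ 0ℓ} (P? : Decidable P) h (f : ℕ → ℕ) n →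
               + sumℕ (map h (filter P? (applyUpTo f n)))
             ≡ ∑ n (λ i → + h (f (i ∸ 1)) ℤ.* (if does (P? (f (i ∸ 1))) then 1ℤ else 0ℤ))
  sum-filter P? h f zero    = refl
  sum-filter P? h f (suc n) = trans front (sym (trans
    (∑-head n (λ i → + h (f (i ∸ 1)) ℤ.* (if does (P? (f (i ∸ 1))) then 1ℤ else 0ℤ)))
    (cong (λ t → + h (f 0) ℤ.* (if does (P? (f 0)) then 1ℤ else 0ℤ) ℤ.+ t) (trans (∑-cong n (λ _ _ → refl)) (sym (sum-filter P? h (f ∘ suc) n))))))
    where
    rest = sumℕ (map h (filter P? (applyUpTo (f ∘ suc) n)))
    front : + sumℕ (map h (filter P? (applyUpTo f (suc n)))) ≡ + h (f 0) ℤ.* (if does (P? (f 0)) then 1ℤ else 0ℤ) ℤ.+ + rest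
    front with does (P? (f 0))
    ... | true  = trans (ℤ.pos-+ (h (f 0)) rest) (cong (ℤ._+ + rest) (sym (ℤ.*-identityʳ (+ h (f 0)))))
    ... | false = sym (trans (cong (ℤ._+ + rest) (ℤ.*-zeroʳ (+ h (f 0)))) (ℤ.+-identityˡ (+ rest)))

  -- At n = 0 both sides are empty sums. Including this case lets the summands of the convolutions
  -- be rewritten at every index, without the bound m < n.
  s≡σ : ∀ k n → s k n ≡ + σ k n
  s≡σ k zero    = refl
  s≡σ k (suc n) = trans (∑-cong (suc n) (λ _ _ → refl)) (sym (sum-filter (_∣? suc n) (_^ k) suc (suc n)))

  sum-map : ∀ h (f : ℕ → ℕ) n → + sumℕ (map h (applyUpTo f n)) ≡ ∑ n (λ i → + h (f (i ∸ 1)))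
  sum-map h f zero    = refl
  sum-map h f (suc n) = begin
    + (h (f 0) ℕ.+ sumℕ (map h (applyUpTo (f ∘ suc) n)))        ≡⟨ ℤ.pos-+ (h (f 0)) _ ⟩
    + h (f 0) ℤ.+ + sumℕ (map h (applyUpTo (f ∘ suc) n))
      ≡⟨ cong (λ t → + h (f 0) ℤ.+ t) (sum-map h (f ∘ suc) n) ⟩
    + h (f 0) ℤ.+ ∑ n (λ i → + h (f (suc (i ∸ 1))))
      -- `suc (i ∸ 1)` and `suc i ∸ 1` differ at i = 0 but agree by computation at successors, the
      -- only indices that `∑-cong` compares.
      ≡⟨ cong (λ t → + h (f 0) ℤ.+ t) (∑-cong n (λ _ _ → refl)) ⟩
    + h (f 0) ℤ.+ ∑ n (λ i → + h (f (suc i ∸ 1)))               ≡⟨ ∑-head n (λ i → + h (f (i ∸ 1))) ⟨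
    ∑ (suc n) (λ i → + h (f (i ∸ 1)))                           ∎

  opaque
    unfolding _⊗_

    ⊗-∑ : ∀ f g n → (f ⊗ g) n ≡ f 0 ℤ.* g n ℤ.+ ∑ n (λ i → f i ℤ.* g (n ∸ i))
    ⊗-∑ f g zero    = refl
    ⊗-∑ f g (suc n) = cong (λ t → f 0 ℤ.* g (suc n) ℤ.+ t)
      (trans (⊗-∑ (shift f) g n) (sym (∑-head n (λ i → f i ℤ.* g (suc n ∸ i)))))

  -- The vanishing constant terms remove the summands at both ends, i = 0 and i = n, which leaves
  -- the range 1 ≤ m < n.
  ⊗-∑₁< : ∀ f g n h → f 0 ≡ 0ℤ → g 0 ≡ 0ℤ → (∀ i → f i ℤ.* g (n ∸ i) ≡ + h i) → (f ⊗ g) n ≡ + ∑₁< n h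
  ⊗-∑₁< f g zero    h f0 g0 fg≡h = trans (⊗-∑ f g 0) (cong (λ x → x ℤ.* g 0 ℤ.+ 0ℤ) f0)
  ⊗-∑₁< f g (suc n) h f0 g0 fg≡h = begin
    (f ⊗ g) (suc n)
      ≡⟨ ⊗-∑ f g (suc n) ⟩
    f 0 ℤ.* g (suc n) ℤ.+ (∑ n (λ i → f i ℤ.* g (suc n ∸ i)) ℤ.+ f (suc n) ℤ.* g (n ∸ n))
      ≡⟨ cong₂ (λ x y → x ℤ.* g (suc n) ℤ.+ (∑ n (λ i → f i ℤ.* g (suc n ∸ i)) ℤ.+ f (suc n) ℤ.* y)) f0 (trans (cong g (ℕ.n∸n≡0 n)) g0) ⟩
    0ℤ ℤ.+ (∑ n (λ i → f i ℤ.* g (suc n ∸ i)) ℤ.+ f (suc n) ℤ.* 0ℤ)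
      ≡⟨ trans (ℤ.+-identityˡ _) (trans (cong (λ t → ∑ n (λ i → f i ℤ.* g (suc n ∸ i)) ℤ.+ t) (ℤ.*-zeroʳ (f (suc n)))) (ℤ.+-identityʳ _)) ⟩
    ∑ n (λ i → f i ℤ.* g (suc n ∸ i))
      ≡⟨ ∑-cong n (λ i _ → fg≡h (suc i)) ⟩
    ∑ n (λ i → + h i)
      ≡⟨ trans (sum-map h suc n) (∑-cong n (λ _ _ → refl)) ⟨
    + ∑₁< (suc n) h ∎

  pos-*₃ : ∀ a b c → + (a ℕ.* b ℕ.* c) ≡ + a ℤ.* + b ℤ.* + c
  pos-*₃ a b c = trans (ℤ.pos-* (a ℕ.* b) c) (cong (ℤ._* + c) (ℤ.pos-* a b))

  open +-*-Solver using (_:*_; _:=_; con) renaming (solve to solveℤ)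

  sum-i : ∀ n → (s 3 ⊗ D (s 5)) n ≡ + (∑[1≤ m < n ] (n ∸ m) ℕ.* σ 3 m ℕ.* σ 5 (n ∸ m))
  sum-i n = ⊗-∑₁< (s 3) (D (s 5)) n _ refl refl (λ m → trans
    (cong₂ (λ x y → x ℤ.* (+ (n ∸ m) ℤ.* y)) (s≡σ 3 m) (s≡σ 5 (n ∸ m)))
    (trans (solveℤ 3 (λ d x y → x :* (d :* y) := d :* x :* y) refl (+ (n ∸ m)) (+ σ 3 m) (+ σ 5 (n ∸ m)))
      (sym (pos-*₃ (n ∸ m) (σ 3 m) (σ 5 (n ∸ m))))))

  sum-ii : ∀ n → (D (s 3) ⊗ s 5) n ≡ + (∑[1≤ m < n ] m ℕ.* σ 3 m ℕ.* σ 5 (n ∸ m))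
  sum-ii n = ⊗-∑₁< (D (s 3)) (s 5) n _ refl refl (λ m → trans
    (cong₂ (λ x y → + m ℤ.* x ℤ.* y) (s≡σ 3 m) (s≡σ 5 (n ∸ m)))
    (sym (pos-*₃ m (σ 3 m) (σ 5 (n ∸ m)))))

  pos-² : ∀ m → + (m ^ 2) ≡ + m ℤ.* (+ m ℤ.* 1ℤ)
  pos-² m = trans (ℤ.pos-* m (m ℕ.* 1)) (cong (λ t → + m ℤ.* t) (ℤ.pos-* m 1))

  sum-iii : ∀ n → (D (D (s 3)) ⊗ s 5) n ≡ + (∑[1≤ m < n ] m ^ 2 ℕ.* σ 3 m ℕ.* σ 5 (n ∸ m))
  sum-iii n = ⊗-∑₁< (D (D (s 3))) (s 5) n _ refl refl (λ m → trans
    (cong₂ (λ x y → + m ℤ.* (+ m ℤ.* x) ℤ.* y) (s≡σ 3 m) (s≡σ 5 (n ∸ m)))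
    (trans (solveℤ 3 (λ d x y → d :* (d :* x) :* y := d :* (d :* con 1ℤ) :* x :* y) refl (+ m) (+ σ 3 m) (+ σ 5 (n ∸ m)))
      (sym (trans (pos-*₃ (m ^ 2) (σ 3 m) (σ 5 (n ∸ m))) (cong (λ t → t ℤ.* + σ 3 m ℤ.* + σ 5 (n ∸ m)) (pos-² m))))))

  sum-iv : ∀ n → (D (s 3) ⊗ D (s 5)) n ≡ + (∑[1≤ m < n ] m ℕ.* (n ∸ m) ℕ.* σ 3 m ℕ.* σ 5 (n ∸ m))
  sum-iv n = ⊗-∑₁< (D (s 3)) (D (s 5)) n _ refl refl (λ m → trans
    (cong₂ (λ x y → + m ℤ.* x ℤ.* (+ (n ∸ m) ℤ.* y)) (s≡σ 3 m) (s≡σ 5 (n ∸ m)))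
    (trans (solveℤ 4 (λ e d x y → e :* x :* (d :* y) := e :* d :* x :* y) refl (+ m) (+ (n ∸ m)) (+ σ 3 m) (+ σ 5 (n ∸ m)))
      (sym (trans (pos-*₃ (m ℕ.* (n ∸ m)) (σ 3 m) (σ 5 (n ∸ m))) (cong (λ t → t ℤ.* + σ 3 m ℤ.* + σ 5 (n ∸ m)) (ℤ.pos-* m (n ∸ m)))))))

  sum-v : ∀ n → (s 3 ⊗ D (D (s 5))) n ≡ + (∑[1≤ m < n ] (n ∸ m) ^ 2 ℕ.* σ 3 m ℕ.* σ 5 (n ∸ m))
  sum-v n = ⊗-∑₁< (s 3) (D (D (s 5))) n _ refl refl (λ m → trans
    (cong₂ (λ x y → x ℤ.* (+ (n ∸ m) ℤ.* (+ (n ∸ m) ℤ.* y))) (s≡σ 3 m) (s≡σ 5 (n ∸ m)))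
    (trans (solveℤ 3 (λ d x y → x :* (d :* (d :* y)) := d :* (d :* con 1ℤ) :* x :* y) refl (+ (n ∸ m)) (+ σ 3 m) (+ σ 5 (n ∸ m)))
      (sym (trans (pos-*₃ ((n ∸ m) ^ 2) (σ 3 m) (σ 5 (n ∸ m))) (cong (λ t → t ℤ.* + σ 3 m ℤ.* + σ 5 (n ∸ m)) (pos-² (n ∸ m)))))))

open Coefficients

open import Data.Rational.Base using (_+_; _-_; _*_; -_; _/_)

-- The passage from ℤ to ℚ.

module Rationals where
  open ≡-Reasoning

  -- `i / suc d` is by definition `fromℚᵘ (mkℚᵘ i d)`, so quotients can be multiplied as
  -- unnormalised fractions, without reasoning about gcds.
  fromℚᵘ-* : ∀ p q → fromℚᵘ (p ℚᵘ.* q) ≡ fromℚᵘ p * fromℚᵘ q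
  fromℚᵘ-* p q = ℚ.toℚᵘ-injective (ℚᵘ.≃-trans (ℚ.toℚᵘ-fromℚᵘ (p ℚᵘ.* q)) (ℚᵘ.≃-sym
    (ℚᵘ.≃-trans (ℚ.toℚᵘ-homo-* (fromℚᵘ p) (fromℚᵘ q)) (ℚᵘ.*-cong (ℚ.toℚᵘ-fromℚᵘ p) (ℚ.toℚᵘ-fromℚᵘ q)))))

  fromℚᵘ-+ : ∀ p q → fromℚᵘ (p ℚᵘ.+ q) ≡ fromℚᵘ p + fromℚᵘ q
  fromℚᵘ-+ p q = ℚ.toℚᵘ-injective (ℚᵘ.≃-trans (ℚ.toℚᵘ-fromℚᵘ (p ℚᵘ.+ q)) (ℚᵘ.≃-sym
    (ℚᵘ.≃-trans (ℚ.toℚᵘ-homo-+ (fromℚᵘ p) (fromℚᵘ q)) (ℚᵘ.+-cong (ℚ.toℚᵘ-fromℚᵘ p) (ℚ.toℚᵘ-fromℚᵘ q)))))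

  /1-* : ∀ i j → (i ℤ.* j) / 1 ≡ i / 1 * (j / 1)
  /1-* i j = fromℚᵘ-* (mkℚᵘ i 0) (mkℚᵘ j 0)

  /1-+ : ∀ i j → (i ℤ.+ j) / 1 ≡ i / 1 + j / 1
  /1-+ i j = trans (cong (_/ 1) (sym (cong₂ ℤ._+_ (ℤ.*-identityʳ i) (ℤ.*-identityʳ j)))) (fromℚᵘ-+ (mkℚᵘ i 0) (mkℚᵘ j 0))

  /-* : ∀ k n → + k / suc n ≡ + k / 1 * (1ℤ / suc n)
  /-* k n = trans (ℚ./-cong (sym (ℤ.*-identityʳ (+ k))) (sym (ℕ.*-identityˡ (suc n)))) (fromℚᵘ-* (mkℚᵘ (+ k) 0) (mkℚᵘ 1ℤ n))

  1/n*n : ∀ n → 1ℤ / suc n * ι (suc n) ≡ 1ℤ / 1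
  1/n*n n = trans (sym (fromℚᵘ-* (mkℚᵘ 1ℤ n) (mkℚᵘ (+ suc n) 0)))
    (ℚ.fromℚᵘ-cong {mkℚᵘ 1ℤ n ℚᵘ.* mkℚᵘ (+ suc n) 0} {mkℚᵘ 1ℤ 0} (*≡* (+-*-Solver.solve 1 (λ x → con 1ℤ :* x :* con 1ℤ :=
             con 1ℤ :* (x :* con 1ℤ)) refl (+ suc n))))
    where open +-*-Solver

  coefficients : ∀ {z a b c} {t f g h : Series} n → κ z ⊗ t ≈ κ a ⊗ f ⊕ κ b ⊗ g ⊕ κ c ⊗ h →
    z / 1 * (t n / 1) ≡ a / 1 * (f n / 1) + b / 1 * (g n / 1) + c / 1 * (h n / 1)
  coefficients {z} {a} {b} {c} {t} {f} {g} {h} n eq = begin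
    z / 1 * (t n / 1)                                               ≡⟨ /1-* z (t n) ⟨
    (z ℤ.* t n) / 1
      ≡⟨ cong (_/ 1) (trans (sym (κ-⊗ z t n)) (trans (eq n) (cong₂ ℤ._+_ (cong₂ ℤ._+_ (κ-⊗ a f n) (κ-⊗ b g n)) (κ-⊗ c h n)))) ⟩
    (a ℤ.* f n ℤ.+ b ℤ.* g n ℤ.+ c ℤ.* h n) / 1
      ≡⟨ trans (/1-+ (a ℤ.* f n ℤ.+ b ℤ.* g n) (c ℤ.* h n)) (cong (_+ (c ℤ.* h n) / 1) (/1-+ (a ℤ.* f n) (b ℤ.* g n))) ⟩
    (a ℤ.* f n) / 1 + (b ℤ.* g n) / 1 + (c ℤ.* h n) / 1
      ≡⟨ cong₂ _+_ (cong₂ _+_ (/1-* a (f n)) (/1-* b (g n))) (/1-* c (h n)) ⟩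
    a / 1 * (f n / 1) + b / 1 * (g n / 1) + c / 1 * (h n / 1)       ∎

  -- The zero term brings `τ-iv` to the three-term shape of `coefficients`.
  τ-iv-padded : κ 1ℤ ⊗ D τ ≈ κ 1ℤ ⊗ D (D (s 9)) ⊕ κ 0ℤ ⊗ D (D (s 9)) ⊕ κ -[1+ 2099 ] ⊗ (D (s 3) ⊗ D (s 5))
  τ-iv-padded = ℛ.trans (⊗-congˡ (κ 1ℤ) τ-iv)
    (solve 2 (λ x y → con 1ℤ :* (x :+ con -[1+ 2099 ] :* y) :=
             con 1ℤ :* x :+ con 0ℤ :* x :+ con -[1+ 2099 ] :* y) ℛ.refl (D (D (s 9))) (D (s 3) ⊗ D (s 5)))
    where open SeriesSolver

  D-/1 : ∀ f n {x} → f n / 1 ≡ x → D f n / 1 ≡ ι n * x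
  D-/1 f n f≡x = trans (/1-* (+ n) (f n)) (cong (_*_ (ι n)) f≡x)

  D-s/1 : ∀ k n → D (s k) n / 1 ≡ ι n * ι (σ k n)
  D-s/1 k n = D-/1 (s k) n (cong (_/ 1) (s≡σ k n))

  DD-s/1 : ∀ k n → D (D (s k)) n / 1 ≡ ι n * (ι n * ι (σ k n))
  DD-s/1 k n = D-/1 (D (s k)) n (D-s/1 k n)

  identity-at : ∀ {z a b c : ℤ} {t f g h : Series} n {t′ f′ g′ h′} → κ z ⊗ t ≈ κ a ⊗ f ⊕ κ b ⊗ g ⊕ κ c ⊗ h →
    t n / 1 ≡ t′ → f n / 1 ≡ f′ → g n / 1 ≡ g′ → h n ≡ + h′ →
    z / 1 * t′ ≡ a / 1 * f′ + b / 1 * g′ + c / 1 * ι h′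
  identity-at {a = a} {b} {c} {f = f} {g} n eq refl refl refl h≡ =
    trans (coefficients n eq) (cong (λ x → a / 1 * (f n / 1) + b / 1 * (g n / 1) + c / 1 * (x / 1)) h≡)

open Rationals

-- Solving the five linear equations for τ(n) over ℚ.

module RationalArithmetic where
  open ℚ-Solver
  open ≡-Reasoning

  solve-i : ∀ T N A B M → + 24 / 1 * T ≡ -[1+ 10 ] / 1 * (N * A) + + 35 / 1 * (N * B) + + 8400 / 1 * M →
            T ≡ - (+ 11 / 24) * N * A + + 35 / 24 * N * B + + 350 / 1 * M
  solve-i T N A B M eq = begin
    T                              ≡⟨ solve 1 (λ t → t := con (+ 1 / 24) :* (con (+ 24 / 1) :* t)) refl T ⟩
    + 1 / 24 * (+ 24 / 1 * T)      ≡⟨ cong (_*_ (+ 1 / 24)) eq ⟩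
    _
      ≡⟨ solve 4 (λ n a b m → con (+ 1 / 24) :* (con (-[1+ 10 ] / 1) :* (n :* a) :+ con (+ 35 / 1) :* (n :* b) :+ con (+ 8400 / 1) :* m) :=
                                        :- con (+ 11 / 24) :* n :* a :+ con (+ 35 / 24) :* n :* b :+ con (+ 350 / 1) :* m) refl N A B M ⟩
    _                              ∎

  solve-ii : ∀ T N A C M → + 36 / 1 * T ≡ + 11 / 1 * (N * A) + + 25 / 1 * (N * C) + -[1+ 12599 ] / 1 * M →
             T ≡ + 11 / 36 * N * A + + 25 / 36 * N * C - + 350 / 1 * M
  solve-ii T N A C M eq = begin
    T                              ≡⟨ solve 1 (λ t → t := con (+ 1 / 36) :* (con (+ 36 / 1) :* t)) refl T ⟩
    + 1 / 36 * (+ 36 / 1 * T)      ≡⟨ cong (_*_ (+ 1 / 36)) eq ⟩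
    _
      ≡⟨ solve 4 (λ n a c m → con (+ 1 / 36) :* (con (+ 11 / 1) :* (n :* a) :+ con (+ 25 / 1) :* (n :* c) :+ con (-[1+ 12599 ] / 1) :* m) :=
                                        con (+ 11 / 36) :* n :* a :+ con (+ 25 / 36) :* n :* c :- con (+ 350 / 1) :* m) refl N A C M ⟩
    _                              ∎

  module _ (r N : ℚ) (rN≡1 : r * N ≡ + 1 / 1) where

    -- The ring solver cannot use r N = 1. The identities below therefore isolate the factor
    -- `r * N`, which is then removed here.
    unit : ∀ X → (r * N) * X ≡ X
    unit X = trans (cong (_* X) rN≡1) (ℚ.*-identityˡ X)

    solve-iii : ∀ T A C M → + 6 / 1 * (N * T) ≡ + 1 / 1 * (N * (N * A)) + + 5 / 1 * (N * (N * C)) + -[1+ 2519 ] / 1 * M →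
                T ≡ + 1 / 6 * N * A + + 5 / 6 * N * C - + 420 / 1 * r * M
    solve-iii T A C M eq = begin
      T                                ≡⟨ unit T ⟨
      (r * N) * T                      ≡⟨ solve 3 (λ r n t → r :* n :* t :=
               r :* (con (+ 1 / 6) :* (con (+ 6 / 1) :* (n :* t)))) refl r N T ⟩
      r * (+ 1 / 6 * (+ 6 / 1 * (N * T)))  ≡⟨ cong (λ x → r * (+ 1 / 6 * x)) eq ⟩
      _
        ≡⟨ solve 5 (λ r n a c m → r :* (con (+ 1 / 6) :* (con (+ 1 / 1) :* (n :* (n :* a)) :+ con (+ 5 / 1) :* (n :* (n :* c)) :+ con (-[1+ 2519 ] / 1) :* m)) :=
                                            (r :* n) :* (con (+ 1 / 6) :* n :* a :+ con (+ 5 / 6) :* n :* c) :- con (+ 420 / 1) :* r :* m) refl r N A C M ⟩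
      _                                ≡⟨ cong (_- + 420 / 1 * r * M) (unit (+ 1 / 6 * N * A + + 5 / 6 * N * C)) ⟩
      _                                ∎

    solve-iv : ∀ T A M → + 1 / 1 * (N * T) ≡ + 1 / 1 * (N * (N * A)) + + 0 / 1 * (N * (N * A)) + -[1+ 2099 ] / 1 * M →
               T ≡ N * A - + 2100 / 1 * r * M
    solve-iv T A M eq = begin
      T                                ≡⟨ unit T ⟨
      (r * N) * T
        ≡⟨ solve 3 (λ r n t → r :* n :* t := r :* (con (+ 1 / 1) :* (n :* t))) refl r N T ⟩
      r * (+ 1 / 1 * (N * T))          ≡⟨ cong (_*_ r) eq ⟩
      _
        ≡⟨ solve 4 (λ r n a m → r :* (con (+ 1 / 1) :* (n :* (n :* a)) :+ con (+ 0 / 1) :* (n :* (n :* a)) :+ con (-[1+ 2099 ] / 1) :* m) :=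
                                            (r :* n) :* (n :* a) :- con (+ 2100 / 1) :* r :* m) refl r N A M ⟩
      _                                ≡⟨ cong (_- + 2100 / 1 * r * M) (unit (N * A)) ⟩
      _                                ∎

    solve-v : ∀ T A B M → + 4 / 1 * (N * T) ≡ -[1+ 0 ] / 1 * (N * (N * A)) + + 5 / 1 * (N * (N * B)) + + 1200 / 1 * M →
              T ≡ - (+ 1 / 4) * N * A + + 5 / 4 * N * B + + 300 / 1 * r * M
    solve-v T A B M eq = begin
      T                                ≡⟨ unit T ⟨
      (r * N) * T                      ≡⟨ solve 3 (λ r n t → r :* n :* t :=
               r :* (con (+ 1 / 4) :* (con (+ 4 / 1) :* (n :* t)))) refl r N T ⟩
      r * (+ 1 / 4 * (+ 4 / 1 * (N * T)))  ≡⟨ cong (λ x → r * (+ 1 / 4 * x)) eq ⟩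
      _
        ≡⟨ solve 5 (λ r n a b m → r :* (con (+ 1 / 4) :* (con (-[1+ 0 ] / 1) :* (n :* (n :* a)) :+ con (+ 5 / 1) :* (n :* (n :* b)) :+ con (+ 1200 / 1) :* m)) :=
                                            (r :* n) :* (:- con (+ 1 / 4) :* n :* a :+ con (+ 5 / 4) :* n :* b) :+ con (+ 300 / 1) :* r :* m) refl r N A B M ⟩
      _                                ≡⟨ cong (_+ + 300 / 1 * r * M) (unit (- (+ 1 / 4) * N * A + + 5 / 4 * N * B)) ⟩
      _                                ∎

open RationalArithmetic

theorem2p2 : (n : ℕ) .{{_ : ℕ.NonZero n}} →
    (τ n / 1 ≡ - (+ 11 / 24) * ι n * ι (σ 9 n) + + 35 / 24 * ι n * ι (σ 5 n)
    + + 350 / 1 * ι (∑[1≤ m < n ] (n ∸ m) ℕ.* σ 3 m ℕ.* σ 5 (n ∸ m)))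
    × (τ n / 1 ≡ + 11 / 36 * ι n * ι (σ 9 n) + + 25 / 36 * ι n * ι (σ 3 n)
    - + 350 / 1 * ι (∑[1≤ m < n ] m ℕ.* σ 3 m ℕ.* σ 5 (n ∸ m)))
    × (τ n / 1 ≡ + 1 / 6 * ι n * ι (σ 9 n) + + 5 / 6 * ι n * ι (σ 3 n)
    - + 420 / n * ι (∑[1≤ m < n ] m ^ 2 ℕ.* σ 3 m ℕ.* σ 5 (n ∸ m)))
    × (τ n / 1 ≡ ι n * ι (σ 9 n)
    - + 2100 / n * ι (∑[1≤ m < n ] m ℕ.* (n ∸ m) ℕ.* σ 3 m ℕ.* σ 5 (n ∸ m)))
    × (τ n / 1 ≡ - (+ 1 / 4) * ι n * ι (σ 9 n) + + 5 / 4 * ι n * ι (σ 5 n)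
    + + 300 / n * ι (∑[1≤ m < n ] (n ∸ m) ^ 2 ℕ.* σ 3 m ℕ.* σ 5 (n ∸ m)))
theorem2p2 n@(suc k) =
    solve-i t N (ι (σ 9 n)) (ι (σ 5 n)) M₁ (identity-at n τ-i refl (D-s/1 9 n) (D-s/1 5 n) (sum-i n))
  , solve-ii t N (ι (σ 9 n)) (ι (σ 3 n)) M₂ (identity-at n τ-ii refl (D-s/1 9 n) (D-s/1 3 n) (sum-ii n))
  , trans (solve-iii r N rN t (ι (σ 9 n)) (ι (σ 3 n)) M₃ (identity-at n τ-iii Dt (DD-s/1 9 n) (DD-s/1 3 n) (sum-iii n)))
      -- So far 420 / n has stood as 420 · (1 / n), with 1 / n as an atom of the ring solver.
      (cong (λ q → + 1 / 6 * N * ι (σ 9 n) + + 5 / 6 * N * ι (σ 3 n) - q * M₃) (sym (/-* 420 k)))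
  , trans (solve-iv r N rN t (ι (σ 9 n)) M₄ (identity-at n τ-iv-padded Dt (DD-s/1 9 n) (DD-s/1 9 n) (sum-iv n)))
      (cong (λ q → N * ι (σ 9 n) - q * M₄) (sym (/-* 2100 k)))
  , trans (solve-v r N rN t (ι (σ 9 n)) (ι (σ 5 n)) M₅ (identity-at n τ-v Dt (DD-s/1 9 n) (DD-s/1 5 n) (sum-v n)))
      (cong (λ q → - (+ 1 / 4) * N * ι (σ 9 n) + + 5 / 4 * N * ι (σ 5 n) + q * M₅) (sym (/-* 300 k)))
  where
  t = τ n / 1
  N = ι n
  r = 1ℤ / n
  rN = 1/n*n k
  Dt = D-/1 τ n refl
  M₁ = ι (∑[1≤ m < n ] (n ∸ m) ℕ.* σ 3 m ℕ.* σ 5 (n ∸ m))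
  M₂ = ι (∑[1≤ m < n ] m ℕ.* σ 3 m ℕ.* σ 5 (n ∸ m))
  M₃ = ι (∑[1≤ m < n ] m ^ 2 ℕ.* σ 3 m ℕ.* σ 5 (n ∸ m))
  M₄ = ι (∑[1≤ m < n ] m ℕ.* (n ∸ m) ℕ.* σ 3 m ℕ.* σ 5 (n ∸ m))
  M₅ = ι (∑[1≤ m < n ] (n ∸ m) ^ 2 ℕ.* σ 3 m ℕ.* σ 5 (n ∸ m))
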